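{- Let $L$ be an even lattice of signature $(b_+,b_-)$, let $\Lambda\subseteq L$ be a sub-lattice of finite index, let $v\in\operatorname{Gr}(L_{\mathbb{R}})=\operatorname{Gr}(\Lambda_{\mathbb{R}})$, let $\Gamma$ be a finite index subgroup of $\operatorname{Mp}_2(\mathbb{Z})$ with image $\tilde\Gamma$ under the involution $(A,\phi)\mapsto(\tilde A,\tilde\phi)$, and let $k,l\in\frac12\mathbb{Z}$. Let $F$ be a modular form of weight $\big(k-\frac{b_+}{2},l-\frac{b_- }{2}\big)$ and representation $\rho_L^*$ with respect to $\Gamma$, and let $G$ be a modular form of weight $\big(k-\frac{b_- }{2},l-\frac{b_+}{2}\big)$ and representation $\rho_L$ with respect to $\tilde\Gamma$. Then $$\Phi_{\Lambda,v}^{\uparrow^{L(-1)}_{\Lambda(-1)}F}=\Phi_{L,v}^{F}\qquad\text{and}\qquad\tilde\Phi_{\Lambda,v}^{\uparrow^{L}_{\Lambda}G}=\tilde\Phi_{L,v}^{G}.$$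
   Context: Lattices. An even lattice is a free $\mathbb{Z}$-module $L$ of finite rank with a non-degenerate symmetric bilinear form $(\cdot,\cdot):L\times L\to\mathbb{Z}$ such that $\lambda^2:=(\lambda,\lambda)$ is even for every $\lambda\in L$. Put $L_{\mathbb{R}}=L\otimes\mathbb{R}$, $L_{\mathbb{C}}=L\otimes\mathbb{C}$; the pairing and $\lambda\mapsto\lambda^2$ are extended bilinearly (no complex conjugation). The dual lattice is $L^*=\{\lambda\in L_{\mathbb{R}}:(\lambda,L)\subseteq\mathbb{Z}\}\supseteq L$, and $D_L=L^*/L$ is a finite group. $\mathbb{C}[D_L]$ has basis $\{\mathfrak{e}_\gamma\}_{\gamma\in D_L}$. Write $\mathbf{e}(w)=e^{2\pi iw}$ and $\mathcal{H}=\{\tau=x+iy\in\mathbb{C}:y>0\}$. $\operatorname{Gr}(L_{\mathbb{R}})$ is the set of orthogonal decompositions $v$: $L_{\mathbb{R}}=v_+\oplus v_-$ with $v_+$ positive definite and $v_-$ negative definite; $\lambda_{v_\pm}$ is the orthogonal projection of $\lambda$ onto $v_\pm$. The Jacobi--Siegel theta function: for $\tau\in\mathcal{H}$, $\zeta\in L_{\mathbb{C}}$, $$\Theta_L(\tau,\zeta;v)=\sum_{\gamma\in D_L}\Big[\sum_{\lambda\in L+\gamma}\mathbf{e}\Big(\tau\tfrac{\lambda_{v_+}^2}{2}+\overline{\tau}\tfrac{\lambda_{v_- }^2}{2}+(\lambda,\zeta)\Big)\Big]\mathfrak{e}_\gamma ,$$ and similarly for $\Lambda$. Metaplectic group. For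 $A=\begin{pmatrix}a&b\\c&d\end{pmatrix}\in\operatorname{SL}_2(\mathbb{R})$ put $A\tau=\frac{a\tau+b}{c\tau+d}$, $j(A,\tau)=c\tau+d$. $\operatorname{Mp}_2(\mathbb{R})$ is the group of pairs $(A,\phi)$ with $A\in\operatorname{SL}_2(\mathbb{R})$, $\phi:\mathcal{H}\to\mathbb{C}$ holomorphic, $\phi^2(\tau)=j(A,\tau)$, with product $(A,\phi)(B,\psi)=(AB,(\phi\circ B)\psi)$; $\operatorname{Mp}_2(\mathbb{Z})$ is the inverse image of $\operatorname{SL}_2(\mathbb{Z})$. It is generated by $T=\big(\begin{pmatrix}1&1\\0&1\end{pmatrix},1\big)$ and $S=\big(\begin{pmatrix}0&-1\\1&0\end{pmatrix},\sqrt{\tau}\big)$ with $\sqrt\tau\in\mathcal{H}$. The Weil representation $\rho_L$ of $\operatorname{Mp}_2(\mathbb{Z})$ on $\mathbb{C}[D_L]$ is given by $$\rho_L(T)\mathfrak{e}_\gamma=\mathbf{e}(\tfrac{\gamma^2}{2})\mathfrak{e}_\gamma,\qquad \rho_L(S)\mathfrak{e}_\gamma=\frac{\mathbf{e}\big(\frac{b_--b_+}{8}\big)}{\sqrt{|D_L|}}\sum_{\delta\in D_L}\mathbf{e}(-(\gamma,\delta))\mathfrak{e}_\delta .$$ $L(-1)$ is $L$ with the forms negated; $\mathbb{C}[D_{L(-1)}]$ has basis $\{\mathfrak{e}_\gamma^*\}_{\gamma\in D_L}$, regarded as dual to $\{\mathfrak{e}_\gamma\}$ via the bilinear pairing $\langle\cdot,\cdot\rangle_L:\mathbb{C}[D_L]\times\mathbb{C}[D_{L(-1)}]\to\mathbb{C}$,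 $\langle\mathfrak{e}_\gamma,\mathfrak{e}_\delta^*\rangle_L=\delta_{\gamma,\delta}$. $\rho_L^*=\rho_{L(-1)}$ is the dual representation: $\langle\rho_L(A,\phi)U,\rho_L^*(A,\phi)V\rangle_L=\langle U,V\rangle_L$. Involution. For $(A,\phi)\in\operatorname{Mp}_2(\mathbb{R})$ with $A=\begin{pmatrix}a&b\\c&d\end{pmatrix}$, put $\tilde A=\begin{pmatrix}a&-b\\-c&d\end{pmatrix}$ and $\tilde\phi(\tau)=\overline{\phi(-\overline\tau)}$. $\omega_L:\mathbb{C}[D_L]\to\mathbb{C}[D_{L(-1)}]$ is the $\mathbb{C}$-linear map with $\omega_L(\mathfrak{e}_\gamma)=\mathfrak{e}_\gamma^*$. Modular forms. For $p,q\in\frac12\mathbb{Z}$, a modular form of weight $(p,q)$ and representation $\rho$ (here a Weil representation or its dual, on the space $V_\rho$) with respect to a finite index subgroup $\Gamma$ is a smooth $F:\mathcal{H}\to V_\rho$ with $F(A\tau)=\phi(\tau)^{2p}\overline{\phi(\tau)}^{2q}\rho(A,\phi)F(\tau)$ for all $\tau\in\mathcal{H}$, $(A,\phi)\in\Gamma$, and with at most linear exponential growth at the cusps (for every $A\in\operatorname{SL}_2(\mathbb{Z})$ there is $C$ with $F(A\tau)=O(e^{Cy})$ as $y\to\infty$, uniformly for $x$ in bounded sets). Associated functions. For a modular form $F$ with representation $\rho_L^*$, $\Phi_{L,v}^F(\tau,\zeta)=\langle\Theta_L(\tau,\zeta;v),F(\tau)\rangle_L$ for $(\tau,\zeta)\in\mathcal{H}\times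 L_{\mathbb{C}}$. For a modular form $G$ with representation $\rho_L$, $\tilde G(\tau)=\omega_L(G(-\overline\tau))$ and $\tilde\Phi_{L,v}^G=\Phi_{L,v}^{\tilde G}$. The same notation is used with $\Lambda$ in place of $L$ (note $\Lambda_{\mathbb{C}}=L_{\mathbb{C}}$). Arrow operators. Let $H=L/\Lambda$, an isotropic subgroup of $D_\Lambda$, with $H^\perp=L^*/\Lambda\subseteq D_\Lambda$ and $D_L=H^\perp/H$. The map $\uparrow^L_\Lambda:\mathbb{C}[D_L]\to\mathbb{C}[D_\Lambda]$ is the linear map $\uparrow^L_\Lambda\mathfrak{e}_\gamma=\sum_{\delta\in H^\perp,\ \delta+H=\gamma}\mathfrak{e}_\delta$. The map $\uparrow^{L(-1)}_{\Lambda(-1)}:\mathbb{C}[D_{L(-1)}]\to\mathbb{C}[D_{\Lambda(-1)}]$ is given by the same formula with $\mathfrak{e}^*$ in place of $\mathfrak{e}$. These maps commute with the Weil representations, hence take modular forms to modular forms of the same weight (applied pointwise in $\tau$). -}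

module Defs where

open import Algebra.Apartness.Bundles using (HeytingField)
open import Algebra.Bundles using (CommutativeRing)
open import Data.Empty using (⊥-elim)
open import Data.Fin.Base using (Fin; zero; suc; toℕ)
open import Data.Fin.Properties using (any?) renaming (_≟_ to _≟ᶠ_)
open import Data.Integer.Base as ℤ using (ℤ; +_; -[1+_])
open import Data.Integer.Divisibility.Signed using (_∣_; ∣m⇒∣-m)
import Data.Integer.Properties as ℤ
open import Data.List.Base using (List; foldr)
open import Data.List.Relation.Binary.Subset.Propositional using (_⊆_)
open import Data.List.Relation.Unary.All using (All)
open import Data.List.Relation.Unary.Unique.Propositional using (Unique)
open import Data.Maybe.Base using (Maybe; just; nothing)
open import Data.Nat.Base as ℕ using (ℕ; zero; suc; NonZero; _!)
import Data.Nat.Properties as ℕ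
open import Data.Nat.Properties using (_!≢0)
open import Data.Product.Base using (Σ; Σ-syntax; ∃-syntax; _×_; _,_; proj₁; proj₂)
open import Data.Sum.Base using (_⊎_; inj₁; inj₂)
open import Data.Unit.Base using (⊤; tt)
open import Data.Vec.Base as Vec using (Vec; lookup; replicate; zipWith)
open import Data.Vec.Functional using (Vector)
open import Data.Vec.Properties using (lookup-zipWith; lookup-map; lookup-replicate)
open import Function.Bundles using (Inverse)
open import Level using (0ℓ)
open import Relation.Binary.Bundles using (Setoid)
open import Relation.Binary.Core using (Rel)
open import Relation.Binary.PropositionalEquality.Core as ≡ using (_≡_)
import Relation.Binary.PropositionalEquality.Properties as ≡
open import Relation.Binary.Structures using (IsStrictPartialOrder)
open import Relation.Nullary.Decidable using (Dec; yes; no; map′)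
open import Relation.Nullary.Negation using (¬_)

module RingExtras {c ℓ} (R : CommutativeRing c ℓ) where

  open CommutativeRing R hiding (zero)
  open import Algebra.Properties.Ring ring
    using (-0#≈0#; -‿distribˡ-*; -‿distribʳ-*; -‿involutive)
  open import Algebra.Properties.AbelianGroup +-abelianGroup using (⁻¹-∙-comm)
  open import Algebra.Properties.Semiring.Mult semiring
    using (×-homo-+; ×1-homo-*) renaming (_×_ to _·_)
  open import Algebra.Properties.Semiring.Sum semiring
    using (sum; sum-cong-≋; ∑-distrib-+; *-distribˡ-sum; sum-syntax)
  open import Algebra.Solver.Ring.AlmostCommutativeRing
    using (fromCommutativeRing; _-Raw-AlmostCommutative⟶_)
  open import Relation.Binary.Reasoning.Setoid setoid

  ι : ℤ → Carrier
  ι (+ n)    = n · 1#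
  ι -[1+ n ] = - (suc n · 1#)

  ι-cong : ∀ {i j} → i ≡ j → ι i ≈ ι j
  ι-cong ≡.refl = refl

  ι-neg : ∀ i → ι (ℤ.- i) ≈ - ι i
  ι-neg (+ zero)  = sym -0#≈0#
  ι-neg (+ suc n) = refl
  ι-neg -[1+ n ]  = sym (-‿involutive _)

  ι-⊖ : ∀ m n → ι (m ℤ.⊖ n) ≈ m · 1# - n · 1#
  ι-⊖ m zero = begin
    ι (m ℤ.⊖ 0)   ≈⟨ ι-cong (ℤ.⊖-≥ {m} {0} ℕ.z≤n) ⟩
    m · 1#        ≈⟨ +-identityʳ _ ⟨
    m · 1# + 0#   ≈⟨ +-congˡ -0#≈0# ⟨
    m · 1# - 0#   ∎
  ι-⊖ zero (suc n) = sym (+-identityˡ _)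
  ι-⊖ (suc m) (suc n) = begin
    ι (suc m ℤ.⊖ suc n)                ≈⟨ ι-cong (ℤ.[1+m]⊖[1+n]≡m⊖n m n) ⟩
    ι (m ℤ.⊖ n)                        ≈⟨ ι-⊖ m n ⟩
    m · 1# - n · 1#                    ≈⟨ +-congʳ (+-identityˡ _) ⟨
    (0# + m · 1#) - n · 1#             ≈⟨ +-congʳ (+-congʳ (-‿inverseʳ 1#)) ⟨
    ((1# - 1#) + m · 1#) - n · 1#      ≈⟨ +-congʳ (+-assoc _ _ _) ⟩
    (1# + (- 1# + m · 1#)) - n · 1#    ≈⟨ +-congʳ (+-congˡ (+-comm _ _)) ⟩
    (1# + (m · 1# - 1#)) - n · 1#      ≈⟨ +-congʳ (+-assoc _ _ _) ⟨
    (suc m · 1# - 1#) - n · 1#         ≈⟨ +-assoc _ _ _ ⟩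
    suc m · 1# + (- 1# - n · 1#)       ≈⟨ +-congˡ (⁻¹-∙-comm _ _) ⟩
    suc m · 1# - suc n · 1#            ∎

  ι-+ : ∀ i j → ι (i ℤ.+ j) ≈ ι i + ι j
  ι-+ (+ m)    (+ n)    = ×-homo-+ 1# m n
  ι-+ (+ m)    -[1+ n ] = ι-⊖ m (suc n)
  ι-+ -[1+ m ] (+ n)    = trans (ι-⊖ n (suc m)) (+-comm _ _)
  ι-+ -[1+ m ] -[1+ n ] = begin
    - (suc (suc (m ℕ.+ n)) · 1#)       ≈⟨ -‿cong (reflexive (≡.cong (λ k → suc k · 1#) (≡.sym (ℕ.+-suc m n)))) ⟩
    - ((suc m ℕ.+ suc n) · 1#)         ≈⟨ -‿cong (×-homo-+ 1# (suc m) (suc n)) ⟩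
    - (suc m · 1# + suc n · 1#)        ≈⟨ ⁻¹-∙-comm _ _ ⟨
    - (suc m · 1#) + - (suc n · 1#)    ∎

  private
    ι-*-pos : ∀ m j → ι (+ m ℤ.* j) ≈ ι (+ m) * ι j
    ι-*-pos m (+ n) = begin
      ι (+ m ℤ.* + n)     ≈⟨ ι-cong (≡.sym (ℤ.pos-* m n)) ⟩
      (m ℕ.* n) · 1#      ≈⟨ ×1-homo-* m n ⟩
      m · 1# * n · 1#     ∎
    ι-*-pos m -[1+ n ] = begin
      ι (+ m ℤ.* ℤ.- (+ suc n))      ≈⟨ ι-cong (≡.sym (ℤ.neg-distribʳ-* (+ m) (+ suc n))) ⟩
      ι (ℤ.- (+ m ℤ.* + suc n))      ≈⟨ ι-neg (+ m ℤ.* + suc n) ⟩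
      - ι (+ m ℤ.* + suc n)          ≈⟨ -‿cong (ι-*-pos m (+ suc n)) ⟩
      - (m · 1# * (suc n · 1#))      ≈⟨ -‿distribʳ-* _ _ ⟩
      m · 1# * - (suc n · 1#)        ∎

  ι-* : ∀ i j → ι (i ℤ.* j) ≈ ι i * ι j
  ι-* (+ m)    j = ι-*-pos m j
  ι-* -[1+ m ] j = begin
    ι (ℤ.- (+ suc m) ℤ.* j)      ≈⟨ ι-cong (≡.sym (ℤ.neg-distribˡ-* (+ suc m) j)) ⟩
    ι (ℤ.- (+ suc m ℤ.* j))      ≈⟨ ι-neg (+ suc m ℤ.* j) ⟩
    - ι (+ suc m ℤ.* j)          ≈⟨ -‿cong (ι-*-pos (suc m) j) ⟩
    - (suc m · 1# * ι j)         ≈⟨ -‿distribˡ-* _ _ ⟩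
    - (suc m · 1#) * ι j         ∎

  ι-1 : ι (+ 1) ≈ 1#
  ι-1 = +-identityʳ 1#

  ι-morphism : CommutativeRing.rawRing ℤ.+-*-commutativeRing
               -Raw-AlmostCommutative⟶ fromCommutativeRing R
  ι-morphism = record
    { ⟦_⟧    = ι
    ; +-homo = ι-+
    ; *-homo = ι-*
    ; -‿homo = ι-neg
    ; 0-homo = refl
    ; 1-homo = ι-1
    }

  private
    weaklyDecide : (i j : ℤ) → Maybe (ι i ≈ ι j)
    weaklyDecide i j with i ℤ.≟ j
    ... | yes i≡j = just (ι-cong i≡j)
    ... | no  _   = nothing

  open import Algebra.Solver.Ring (CommutativeRing.rawRing ℤ.+-*-commutativeRing)
    (fromCommutativeRing R) ι-morphism weaklyDecide public
    using (solve; _:+_; _:*_; _:-_; :-_; con; _:=_)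

  form : ∀ {n} → (Fin n → Fin n → Carrier) → Vector Carrier n → Vector Carrier n → Carrier
  form {n} g x y = ∑[ i < n ] ∑[ j < n ] ((x i * g i j) * y j)

  private
    double-cong : ∀ {n} {f f′ : Fin n → Fin n → Carrier} → (∀ i j → f i j ≈ f′ i j) →
      ∑[ i < n ] ∑[ j < n ] f i j ≈ ∑[ i < n ] ∑[ j < n ] f′ i j
    double-cong eq = sum-cong-≋ λ i → sum-cong-≋ λ j → eq i j

  form-cong : ∀ {n} {g g′ : Fin n → Fin n → Carrier} {x x′ y y′ : Vector Carrier n} →
    (∀ i j → g i j ≈ g′ i j) → (∀ i → x i ≈ x′ i) → (∀ i → y i ≈ y′ i) →
    form g x y ≈ form g′ x′ y′
  form-cong g≈ x≈ y≈ = double-cong λ i j → *-cong (*-cong (x≈ i) (g≈ i j)) (y≈ j)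

  form-+ˡ : ∀ {n} (g : Fin n → Fin n → Carrier) (x x′ y : Vector Carrier n) →
    form g (λ i → x i + x′ i) y ≈ form g x y + form g x′ y
  form-+ˡ {n} g x x′ y = begin
    form g (λ i → x i + x′ i) y
      ≈⟨ double-cong (λ i j → solve 4 (λ a b c d → ((a :+ b) :* c) :* d := (a :* c) :* d :+ (b :* c) :* d) refl (x i) (x′ i) (g i j) (y j)) ⟩
    ∑[ i < n ] ∑[ j < n ] ((x i * g i j) * y j + (x′ i * g i j) * y j)
      ≈⟨ sum-cong-≋ (λ i → ∑-distrib-+ (λ j → (x i * g i j) * y j) (λ j → (x′ i * g i j) * y j)) ⟩
    ∑[ i < n ] ((∑[ j < n ] ((x i * g i j) * y j)) + (∑[ j < n ] ((x′ i * g i j) * y j)))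
      ≈⟨ ∑-distrib-+ (λ i → ∑[ j < n ] ((x i * g i j) * y j)) (λ i → ∑[ j < n ] ((x′ i * g i j) * y j)) ⟩
    form g x y + form g x′ y ∎

  form-negate : ∀ {n} (g : Fin n → Fin n → Carrier) (x y : Vector Carrier n) →
    form (λ i j → - g i j) x y ≈ - form g x y
  form-negate {n} g x y = begin
    form (λ i j → - g i j) x y
      ≈⟨ double-cong (λ i j → solve 3 (λ a c d → (a :* (:- c)) :* d := (:- con (+ 1)) :* ((a :* c) :* d)) refl (x i) (g i j) (y j)) ⟩
    ∑[ i < n ] ∑[ j < n ] ((- ι (+ 1)) * ((x i * g i j) * y j))
      ≈⟨ sum-cong-≋ (λ i → sym (*-distribˡ-sum (- ι (+ 1)) (λ j → (x i * g i j) * y j))) ⟩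
    ∑[ i < n ] ((- ι (+ 1)) * (∑[ j < n ] ((x i * g i j) * y j)))
      ≈⟨ *-distribˡ-sum (- ι (+ 1)) (λ i → ∑[ j < n ] ((x i * g i j) * y j)) ⟨
    (- ι (+ 1)) * form g x y
      ≈⟨ solve 1 (λ a → (:- con (+ 1)) :* a := :- a) refl (form g x y) ⟩
    - form g x y ∎

module _ {c ℓ} (R : CommutativeRing c ℓ) where

  open CommutativeRing R hiding (zero)
  open RingExtras R
  open import Algebra.Properties.Semiring.Sum semiring using (sum; sum-cong-≋)
  open import Algebra.Properties.Semiring.Sum (CommutativeRing.semiring ℤ.+-*-commutativeRing)
    using () renaming (sum to sumℤ)
  open RingExtras ℤ.+-*-commutativeRing using () renaming (form to formℤ)

  private
    ι-sum : ∀ {n} (f : Fin n → ℤ) → ι (sumℤ f) ≈ sum (λ i → ι (f i))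
    ι-sum {zero}  f = refl
    ι-sum {suc n} f = trans (ι-+ (f zero) _) (+-congˡ (ι-sum (λ i → f (suc i))))

  ι-form : ∀ {n} (g : Fin n → Fin n → ℤ) (x y : Vector ℤ n) →
    ι (formℤ g x y) ≈ form (λ i j → ι (g i j)) (λ i → ι (x i)) (λ j → ι (y j))
  ι-form g x y =
    trans (ι-sum (λ i → sumℤ (λ j → (x i ℤ.* g i j) ℤ.* y j))) (sum-cong-≋ λ i →
    trans (ι-sum (λ j → (x i ℤ.* g i j) ℤ.* y j)) (sum-cong-≋ λ j →
    trans (ι-* (x i ℤ.* g i j) (y j)) (*-congʳ (ι-* (x i) (g i j)))))

-- The ℤ-module L is ℤⁿ (a basis has been chosen), and gram is the matrix of
-- the bilinear form in that basis.

LatVec : ℕ → Set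
LatVec n = Vec ℤ n

0ᴸ : ∀ {n} → LatVec n
0ᴸ {n} = replicate n (+ 0)

infixl 6 _+ᴸ_
infix  8 -ᴸ_

_+ᴸ_ : ∀ {n} → LatVec n → LatVec n → LatVec n
_+ᴸ_ = zipWith ℤ._+_

-ᴸ_ : ∀ {n} → LatVec n → LatVec n
-ᴸ_ = Vec.map (λ i → ℤ.- i)

record EvenLattice : Set where
  field
    rank : ℕ
    gram : Fin rank → Fin rank → ℤ

  ⟪_,_⟫ : LatVec rank → LatVec rank → ℤ
  ⟪ x , y ⟫ = RingExtras.form ℤ.+-*-commutativeRing gram (lookup x) (lookup y)

  field
    symmetric     : ∀ i j → gram i j ≡ gram j i
    even          : ∀ x → + 2 ∣ ⟪ x , x ⟫
    nondegenerate : ∀ x → (∀ y → ⟪ x , y ⟫ ≡ + 0) → x ≡ 0ᴸ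

open EvenLattice using (rank; gram)

infix 9 _⟨-1⟩

_⟨-1⟩ : EvenLattice → EvenLattice
L ⟨-1⟩ = record
  { rank          = rank L
  ; gram          = λ i j → ℤ.- gram L i j
  ; symmetric     = λ i j → ≡.cong (λ m → ℤ.- m) (L.symmetric i j)
  ; even          = λ x → ≡.subst (+ 2 ∣_) (≡.sym (neg x x)) (∣m⇒∣-m (L.even x))
  ; nondegenerate = λ x x⊥ → L.nondegenerate x λ y →
      ℤ.neg-injective (≡.trans (≡.sym (neg x y)) (x⊥ y))
  }
  where
  module L = EvenLattice L
  neg : ∀ x y → RingExtras.form ℤ.+-*-commutativeRing (λ i j → ℤ.- gram L i j) (lookup x) (lookup y)
              ≡ ℤ.- L.⟪ x , y ⟫
  neg x y = RingExtras.form-negate ℤ.+-*-commutativeRing (gram L) (lookup x) (lookup y)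

-- A finite-index subgroup of ℤⁿ. It does not depend on the form, so the same
-- Λ serves as a sublattice of L and, as Λ(-1), of L(-1).

record Sublattice (n : ℕ) : Set₁ where
  infix 4 _∈ᴹ
  field
    _∈ᴹ       : LatVec n → Set
    0-closed  : 0ᴸ ∈ᴹ
    +-closed  : ∀ {x y} → x ∈ᴹ → y ∈ᴹ → (x +ᴸ y) ∈ᴹ
    neg-closed : ∀ {x} → x ∈ᴹ → (-ᴸ x) ∈ᴹ
    cosets    : ℕ
    coset     : Fin cosets → LatVec n
    covered   : ∀ x → ∃[ i ] ((x +ᴸ (-ᴸ coset i)) ∈ᴹ)

open Sublattice using (_∈ᴹ)

whole : ∀ {n} → Sublattice n
whole = record
  { _∈ᴹ        = λ _ → ⊤
  ; 0-closed   = tt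
  ; +-closed   = λ _ _ → tt
  ; neg-closed = λ _ → tt
  ; cosets     = 1
  ; coset      = λ _ → 0ᴸ
  ; covered    = λ _ → zero , tt
  }

record SL₂ℤ : Set where
  field
    a b c d : ℤ
    det     : a ℤ.* d ℤ.- b ℤ.* c ≡ + 1

infix 4 _≈ˢ_

_≈ˢ_ : SL₂ℤ → SL₂ℤ → Set
A ≈ˢ B = A.a ≡ B.a × A.b ≡ B.b × A.c ≡ B.c × A.d ≡ B.d
  where
  module A = SL₂ℤ A
  module B = SL₂ℤ B

infixl 7 _*ˢ_

_*ˢ_ : SL₂ℤ → SL₂ℤ → SL₂ℤ
A *ˢ B = record
  { a   = A.a ℤ.* B.a ℤ.+ A.b ℤ.* B.c
  ; b   = A.a ℤ.* B.b ℤ.+ A.b ℤ.* B.d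
  ; c   = A.c ℤ.* B.a ℤ.+ A.d ℤ.* B.c
  ; d   = A.c ℤ.* B.b ℤ.+ A.d ℤ.* B.d
  ; det = ≡.trans
      (solve 8 (λ a b c d a′ b′ c′ d′ →
        (a :* a′ :+ b :* c′) :* (c :* b′ :+ d :* d′) :- (a :* b′ :+ b :* d′) :* (c :* a′ :+ d :* c′)
        := (a :* d :- b :* c) :* (a′ :* d′ :- b′ :* c′)) ≡.refl A.a A.b A.c A.d B.a B.b B.c B.d)
      (≡.cong₂ ℤ._*_ A.det B.det)
  }
  where
  module A = SL₂ℤ A
  module B = SL₂ℤ B
  open RingExtras ℤ.+-*-commutativeRing using (solve; _:+_; _:*_; _:-_; _:=_)

1ˢ Tˢ Sˢ : SL₂ℤ
1ˢ = record { a = + 1 ; b = + 0 ; c = + 0 ; d = + 1 ; det = ≡.refl }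
Tˢ = record { a = + 1 ; b = + 1 ; c = + 0 ; d = + 1 ; det = ≡.refl }
Sˢ = record { a = + 0 ; b = -[1+ 0 ] ; c = + 1 ; d = + 0 ; det = ≡.refl }

record ½ℤ : Set where
  constructor _/2
  field
    twice : ℤ

_-½_ : ½ℤ → ℕ → ½ℤ
(m /2) -½ b = (m ℤ.- + b) /2

-- The library has no real numbers. A Cauchy complete Archimedean ordered field
-- is unique up to unique isomorphism, and everything below is stated for an
-- arbitrary one.

record RealField : Set₁ where
  infix 4 _<_ _≤_
  field
    heytingField : HeytingField 0ℓ 0ℓ 0ℓ
  open HeytingField heytingField public hiding (zero)
  field
    _<_                  : Rel Carrier 0ℓ
    isStrictPartialOrder : IsStrictPartialOrder _≈_ _<_
    #⇒<⊎>                : ∀ {x y} → x # y → x < y ⊎ y < x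
    <⇒#                  : ∀ {x y} → x < y → x # y
    +-monoˡ-<            : ∀ {x y} z → x < y → x + z < y + z
    *-pos                : ∀ {x y} → 0# < x → 0# < y → 0# < x * y

  commutativeRing : CommutativeRing 0ℓ 0ℓ
  commutativeRing = record { isCommutativeRing = isCommutativeRing }
  open RingExtras commutativeRing public

  _≤_ : Rel Carrier 0ℓ
  x ≤ y = ¬ (y < x)

  Within : Carrier → Carrier → Carrier → Set
  Within ε x y = (x - y < ε) × (y - x < ε)

  field
    archimedean : ∀ x → ∃[ n ] (x < ι (+ n))
    complete    : ∀ (u : ℕ → Carrier) →
      (∀ ε → 0# < ε → ∃[ N ] (∀ m n → N ℕ.≤ m → N ℕ.≤ n → Within ε (u m) (u n))) →
      ∃[ x ] (∀ ε → 0# < ε → ∃[ N ] (∀ n → N ℕ.≤ n → Within ε (u n) x))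

module RealExtras (𝓡 : RealField) where

  open RealField 𝓡 renaming (Carrier to ℝ)
  open IsStrictPartialOrder isStrictPartialOrder using (<-respʳ-≈; <-respˡ-≈; irrefl; asym)
    renaming (trans to <-trans)
  open import Algebra.Apartness.Properties.HeytingCommutativeRing heytingCommutativeRing
    public
    using (1#0; x-0≈x; #-congʳ; invertibleʳ⇒#; x#0y#0→xy#0)
  open import Relation.Binary.Reasoning.Setoid (CommutativeRing.setoid commutativeRing)

  private
    <-resp : ∀ {x x′ y y′} → x ≈ x′ → y ≈ y′ → x < y → x′ < y′
    <-resp p q r = <-respʳ-≈ q (<-respˡ-≈ p r)

    neg⇒pos : ∀ {x} → x < 0# → 0# < - x
    neg⇒pos {x} x<0 = <-resp (-‿inverseʳ x) (+-identityˡ (- x)) (+-monoˡ-< (- x) x<0)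

    pos⇒neg : ∀ {x} → 0# < x → - x < 0#
    pos⇒neg {x} 0<x = <-resp (+-identityˡ (- x)) (-‿inverseʳ x) (+-monoˡ-< (- x) 0<x)

  #0⇒sq-pos : ∀ {x} → x # 0# → 0# < x * x
  #0⇒sq-pos {x} x#0 with #⇒<⊎> x#0
  ... | inj₁ x<0 = <-respʳ-≈ (solve 1 (λ a → (:- a) :* (:- a) := a :* a) refl x)
                     (*-pos (neg⇒pos x<0) (neg⇒pos x<0))
  ... | inj₂ 0<x = *-pos 0<x 0<x

  0<1 : 0# < 1#
  0<1 = <-respʳ-≈ (*-identityˡ 1#) (#0⇒sq-pos 1#0)

  ι-pos : ∀ n → 0# < ι (+ suc n)
  ι-pos zero    = <-respʳ-≈ (sym (+-identityʳ 1#)) 0<1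
  ι-pos (suc n) = <-trans (ι-pos n) (<-resp (+-identityˡ _) refl (+-monoˡ-< (ι (+ suc n)) 0<1))

  ι-#0 : ∀ i → ¬ (i ≡ + 0) → ι i # 0#
  ι-#0 (+ zero)  i≢0 = ⊥-elim (i≢0 ≡.refl)
  ι-#0 (+ suc n) i≢0 = #-sym (<⇒# (ι-pos n))
  ι-#0 -[1+ n ]  i≢0 = <⇒# (pos⇒neg (ι-pos n))

  inverse : ∀ {x} → x # 0# → ∃[ y ] (x * y ≈ 1#)
  inverse {x} x#0 with #⇒invertible x#0
  ... | y , _ , inv = y , trans (*-congʳ (sym (x-0≈x x))) inv

  *-cancel-pos : ∀ {x y} → 0# < x → x * y ≈ 1# → 0# < y
  *-cancel-pos {x} {y} 0<x xy≈1 = <-respʳ-≈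
    (begin
      x * (y * y)   ≈⟨ *-assoc x y y ⟨
      (x * y) * y   ≈⟨ *-congʳ xy≈1 ⟩
      1# * y        ≈⟨ *-identityˡ y ⟩
      y             ∎)
    (*-pos 0<x (#0⇒sq-pos y#0))
    where
    y#0 : y # 0#
    y#0 = invertibleʳ⇒# (x , trans (*-congʳ (x-0≈x y)) (trans (*-comm y x) xy≈1))

  x*y#0⇒x#0 : ∀ {x y} → x * y # 0# → x # 0#
  x*y#0⇒x#0 {x} {y} xy#0 with inverse xy#0
  ... | z , xyz≈1 = invertibleʳ⇒#
    (y * z , trans (*-congʳ (x-0≈x x)) (trans (sym (*-assoc x y z)) xyz≈1))

  sq-nonneg : ∀ x → 0# ≤ x * x
  sq-nonneg x x²<0 = asym x²<0 (#0⇒sq-pos (x*y#0⇒x#0 (<⇒# x²<0)))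

  sum-sq-pos : ∀ x {y} → y # 0# → 0# < x * x + y * y
  sum-sq-pos x {y} y#0 = cases (#-cotrans (<⇒# 0<y²) s)
    where
    s = x * x + y * y
    0<y² : 0# < y * y
    0<y² = #0⇒sq-pos y#0
    s≮y² : ¬ (s < y * y)
    s≮y² s<y² = sq-nonneg x (<-resp
      (solve 2 (λ a b → a :+ b :- b := a) refl (x * x) (y * y)) (-‿inverseʳ (y * y))
      (+-monoˡ-< (- (y * y)) s<y²))
    cases : 0# # s ⊎ s # y * y → 0# < s
    cases (inj₁ 0#s) with #⇒<⊎> 0#s
    ... | inj₁ 0<s = 0<s
    ... | inj₂ s<0 = ⊥-elim (s≮y² (<-trans s<0 0<y²))
    cases (inj₂ s#y²) with #⇒<⊎> s#y²
    ... | inj₁ s<y² = ⊥-elim (s≮y² s<y²)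
    ... | inj₂ y²<s = <-trans 0<y² y²<s

  recip : (n : ℕ) .{{_ : NonZero n}} → ℝ
  recip (suc n) = proj₁ (inverse (#-sym (<⇒# (ι-pos n))))

module Complex (𝓡 : RealField) where

  open RealField 𝓡 renaming (Carrier to ℝ)
  open RealExtras 𝓡
  open IsStrictPartialOrder isStrictPartialOrder using (<-respʳ-≈)
  open import Relation.Binary.Reasoning.Setoid (CommutativeRing.setoid commutativeRing)

  record ℂ : Set where
    constructor _+i_
    field
      re im : ℝ
  open ℂ public

  infix 4 _≈ᶜ_

  record _≈ᶜ_ (z w : ℂ) : Set where
    constructor _,ᶜ_
    field
      re≈ : re z ≈ re w
      im≈ : im z ≈ im w
  open _≈ᶜ_ public

  infixl 6 _+ᶜ_ _-ᶜ_
  infixl 7 _*ᶜ_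
  infix  8 -ᶜ_

  _+ᶜ_ _*ᶜ_ : ℂ → ℂ → ℂ
  z +ᶜ w = (re z + re w) +i (im z + im w)
  z *ᶜ w = (re z * re w - im z * im w) +i (re z * im w + im z * re w)

  -ᶜ_ : ℂ → ℂ
  -ᶜ z = (- re z) +i (- im z)

  _-ᶜ_ : ℂ → ℂ → ℂ
  z -ᶜ w = z +ᶜ (-ᶜ w)

  ofℝ : ℝ → ℂ
  ofℝ x = x +i 0#

  0ᶜ 1ᶜ 𝕚 : ℂ
  0ᶜ = ofℝ 0#
  1ᶜ = ofℝ 1#
  𝕚  = 0# +i 1#

  conj : ℂ → ℂ
  conj z = re z +i (- im z)

  normSq : ℂ → ℝ
  normSq z = re z * re z + im z * im z

  ℂ-commutativeRing : CommutativeRing 0ℓ 0ℓ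
  ℂ-commutativeRing = record
    { Carrier = ℂ ; _≈_ = _≈ᶜ_ ; _+_ = _+ᶜ_ ; _*_ = _*ᶜ_ ; -_ = -ᶜ_ ; 0# = 0ᶜ ; 1# = 1ᶜ
    ; isCommutativeRing = record
      { isRing = record
        { +-isAbelianGroup = record
          { isGroup = record
            { isMonoid = record
              { isSemigroup = record
                { isMagma = record
                  { isEquivalence = record
                    { refl  = refl ,ᶜ refl
                    ; sym   = λ p → sym (re≈ p) ,ᶜ sym (im≈ p)
                    ; trans = λ p q → trans (re≈ p) (re≈ q) ,ᶜ trans (im≈ p) (im≈ q)
                    }
                  ; ∙-cong = λ p q → +-cong (re≈ p) (re≈ q) ,ᶜ +-cong (im≈ p) (im≈ q)
                  }
                ; assoc = λ _ _ _ → +-assoc _ _ _ ,ᶜ +-assoc _ _ _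
                }
              ; identity = (λ _ → +-identityˡ _ ,ᶜ +-identityˡ _)
                         , (λ _ → +-identityʳ _ ,ᶜ +-identityʳ _)
              }
            ; inverse = (λ _ → -‿inverseˡ _ ,ᶜ -‿inverseˡ _)
                      , (λ _ → -‿inverseʳ _ ,ᶜ -‿inverseʳ _)
            ; ⁻¹-cong = λ p → -‿cong (re≈ p) ,ᶜ -‿cong (im≈ p)
            }
          ; comm = λ _ _ → +-comm _ _ ,ᶜ +-comm _ _
          }
        ; *-cong = λ p q →
               +-cong (*-cong (re≈ p) (re≈ q)) (-‿cong (*-cong (im≈ p) (im≈ q)))
            ,ᶜ +-cong (*-cong (re≈ p) (im≈ q)) (*-cong (im≈ p) (re≈ q))
        ; *-assoc = *ᶜ-assoc
        ; *-identity = (λ z → *ᶜ-identityˡ z)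
                     , (λ z → ≈ᶜ-trans (*ᶜ-comm z 1ᶜ) (*ᶜ-identityˡ z))
        ; distrib = *ᶜ-distribˡ
                  , (λ x y z → ≈ᶜ-trans (*ᶜ-comm (y +ᶜ z) x) (≈ᶜ-trans (*ᶜ-distribˡ x y z)
                      (+-cong (re≈ (*ᶜ-comm x y)) (re≈ (*ᶜ-comm x z))
                       ,ᶜ +-cong (im≈ (*ᶜ-comm x y)) (im≈ (*ᶜ-comm x z)))))
        }
      ; *-comm = *ᶜ-comm
      }
    }
    where
    abstract
      ≈ᶜ-trans : ∀ {x y z} → x ≈ᶜ y → y ≈ᶜ z → x ≈ᶜ z
      ≈ᶜ-trans p q = trans (re≈ p) (re≈ q) ,ᶜ trans (im≈ p) (im≈ q)
      *ᶜ-comm : ∀ x y → x *ᶜ y ≈ᶜ y *ᶜ x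
      *ᶜ-comm x y =
           solve 4 (λ a b c d → a :* c :- b :* d := c :* a :- d :* b) refl (re x) (im x) (re y) (im y)
        ,ᶜ solve 4 (λ a b c d → a :* d :+ b :* c := c :* b :+ d :* a) refl (re x) (im x) (re y) (im y)
      *ᶜ-identityˡ : ∀ z → 1ᶜ *ᶜ z ≈ᶜ z
      *ᶜ-identityˡ z =
           trans (+-congʳ (*-identityˡ _)) (solve 2 (λ a b → a :- con (+ 0) :* b := a) refl (re z) (im z))
        ,ᶜ trans (+-congʳ (*-identityˡ _)) (solve 2 (λ a b → b :+ con (+ 0) :* a := b) refl (re z) (im z))
      *ᶜ-distribˡ : ∀ x y z → x *ᶜ (y +ᶜ z) ≈ᶜ x *ᶜ y +ᶜ x *ᶜ z
      *ᶜ-distribˡ x y z =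
           solve 6 (λ a b c d e f →
             a :* (c :+ e) :- b :* (d :+ f) := (a :* c :- b :* d) :+ (a :* e :- b :* f)) refl
             (re x) (im x) (re y) (im y) (re z) (im z)
        ,ᶜ solve 6 (λ a b c d e f →
             a :* (d :+ f) :+ b :* (c :+ e) := (a :* d :+ b :* c) :+ (a :* f :+ b :* e)) refl
             (re x) (im x) (re y) (im y) (re z) (im z)
      *ᶜ-assoc : ∀ x y z → (x *ᶜ y) *ᶜ z ≈ᶜ x *ᶜ (y *ᶜ z)
      *ᶜ-assoc x y z =
              solve 6 (λ a b c d e f →
                   (a :* c :- b :* d) :* e :- (a :* d :+ b :* c) :* f
                   := a :* (c :* e :- d :* f) :- b :* (c :* f :+ d :* e)) refl
                   (re x) (im x) (re y) (im y) (re z) (im z)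
           ,ᶜ solve 6 (λ a b c d e f →
                   (a :* c :- b :* d) :* f :+ (a :* d :+ b :* c) :* e
                   := a :* (c :* f :+ d :* e) :+ b :* (c :* e :- d :* f)) refl
                   (re x) (im x) (re y) (im y) (re z) (im z)

  module ℂR = CommutativeRing ℂ-commutativeRing
  open import Algebra.Properties.Semiring.Exp ℂR.semiring public
    using () renaming (_^_ to _^ᶜ_)
  open import Algebra.Properties.Semiring.Sum ℂR.semiring public
    using (sum-syntax)

  ιᶜ : ℤ → ℂ
  ιᶜ m = ofℝ (ι m)

  record Inverseᶜ (z : ℂ) : Set where
    constructor _because_
    field
      inv   : ℂ
      inv-* : z *ᶜ inv ≈ᶜ 1ᶜ

  zpow : (z : ℂ) → Inverseᶜ z → ℤ → ℂ
  zpow z _             (+ n)    = z ^ᶜ n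
  zpow z (w because _) -[1+ n ] = w ^ᶜ suc n

  abstract
    conj-inverse-* : ∀ z w → z *ᶜ w ≈ᶜ 1ᶜ → conj z *ᶜ conj w ≈ᶜ 1ᶜ
    conj-inverse-* z w p =
       trans (solve 4 (λ a b c d → a :* c :- (:- b) :* (:- d) := a :* c :- b :* d) refl
               (re z) (im z) (re w) (im w)) (re≈ p)
      ,ᶜ trans (solve 4 (λ a b c d → a :* (:- d) :+ (:- b) :* c := :- (a :* d :+ b :* c)) refl
               (re z) (im z) (re w) (im w))
       (trans (-‿cong (im≈ p)) (sym (ι-neg (+ 0))))

  conj-inverse : ∀ z → Inverseᶜ z → Inverseᶜ (conj z)
  conj-inverse z (w because p) = conj w because conj-inverse-* z w p

  record ℋ : Set where
    field
      x y : ℝ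
      y>0 : 0# < y

  toℂ : ℋ → ℂ
  toℂ τ = ℋ.x τ +i ℋ.y τ

  -conjᴴ_ : ℋ → ℋ
  -conjᴴ τ = record { x = - ℋ.x τ ; y = ℋ.y τ ; y>0 = ℋ.y>0 τ }

  num j : SL₂ℤ → ℋ → ℂ
  num A τ = ιᶜ (SL₂ℤ.a A) *ᶜ toℂ τ +ᶜ ιᶜ (SL₂ℤ.b A)
  j   A τ = ιᶜ (SL₂ℤ.c A) *ᶜ toℂ τ +ᶜ ιᶜ (SL₂ℤ.d A)

  private
    re-affine : ∀ m n τ → re (ιᶜ m *ᶜ toℂ τ +ᶜ ιᶜ n) ≈ ι m * ℋ.x τ + ι n
    re-affine m n τ = solve 4 (λ m n x y → (m :* x :- con (+ 0) :* y) :+ n := m :* x :+ n) refl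
      (ι m) (ι n) (ℋ.x τ) (ℋ.y τ)

    im-affine : ∀ m n τ → im (ιᶜ m *ᶜ toℂ τ +ᶜ ιᶜ n) ≈ ι m * ℋ.y τ
    im-affine m n τ = solve 3 (λ m x y → (m :* y :+ con (+ 0) :* x) :+ con (+ 0) := m :* y) refl
      (ι m) (ℋ.x τ) (ℋ.y τ)

    j-normSq : ∀ A τ → 0# < normSq (j A τ)
    j-normSq A τ with SL₂ℤ.c A ℤ.≟ + 0
    ... | no c≢0 = sum-sq-pos (re (j A τ)) (#-congʳ (sym (im-affine c d τ))
                     (x#0y#0→xy#0 (ι-#0 c c≢0) (#-sym (<⇒# (ℋ.y>0 τ)))))
      where open SL₂ℤ A
    ... | yes c≡0 = <-respʳ-≈ (+-comm _ _) (sum-sq-pos (im (j A τ)) (#-congʳ (sym re≈d) (ι-#0 d d≢0)))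
      where
      open SL₂ℤ A
      d≢0 : ¬ (d ≡ + 0)
      d≢0 d≡0 = 0≢1 (≡.trans (≡.sym (≡.cong₂ ℤ._-_
        (≡.trans (≡.cong (a ℤ.*_) d≡0) (ℤ.*-zeroʳ a))
        (≡.trans (≡.cong (b ℤ.*_) c≡0) (ℤ.*-zeroʳ b)))) det)
        where
        0≢1 : ¬ (+ 0 ≡ + 1)
        0≢1 ()
      re≈d : re (j A τ) ≈ ι d
      re≈d = trans (re-affine c d τ) (trans (+-congʳ (*-congʳ (ι-cong c≡0)))
        (solve 2 (λ x d → con (+ 0) :* x :+ d := d) refl (ℋ.x τ) (ι d)))

    N⁻¹ : ∀ A τ → ∃[ r ] (normSq (j A τ) * r ≈ 1#)
    N⁻¹ A τ = inverse (#-sym (<⇒# (j-normSq A τ)))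

    abstract
      j-inverse-* : ∀ w r → normSq w * r ≈ 1# → w *ᶜ (conj w *ᶜ ofℝ r) ≈ᶜ 1ᶜ
      j-inverse-* w r Nr≈1 =
           trans (solve 3 (λ u v r → u :* (u :* r :- (:- v) :* con (+ 0)) :- v :* (u :* con (+ 0) :+ (:- v) :* r)
                     := (u :* u :+ v :* v) :* r) refl (re w) (im w) r) Nr≈1
        ,ᶜ solve 3 (λ u v r → u :* (u :* con (+ 0) :+ (:- v) :* r) :+ v :* (u :* r :- (:- v) :* con (+ 0))
                     := con (+ 0)) refl (re w) (im w) r

  j-inverse : ∀ A τ → Inverseᶜ (j A τ)
  j-inverse A τ = (conj (j A τ) *ᶜ ofℝ r) because j-inverse-* (j A τ) r (proj₂ (N⁻¹ A τ))
    where
    r = proj₁ (N⁻¹ A τ)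

  quot : SL₂ℤ → ℋ → ℂ
  quot A τ = num A τ *ᶜ Inverseᶜ.inv (j-inverse A τ)

  private
    quot-im : ∀ A τ → im (quot A τ) ≈ ℋ.y τ * proj₁ (N⁻¹ A τ)
    quot-im A τ = im-q
      where
      open SL₂ℤ A using (a; b; c; d; det)
      open ℋ τ using (x; y)
      r : ℝ
      r = proj₁ (N⁻¹ A τ)
      det≈1 : ι a * ι d - ι b * ι c ≈ ι (+ 1)
      det≈1 = begin
        ι a * ι d - ι b * ι c                   ≈⟨ +-cong (ι-* a d) (-‿cong (ι-* b c)) ⟨
        ι (a ℤ.* d) - ι (b ℤ.* c)               ≈⟨ +-congˡ (ι-neg (b ℤ.* c)) ⟨
        ι (a ℤ.* d) + ι (ℤ.- (b ℤ.* c))         ≈⟨ ι-+ (a ℤ.* d) (ℤ.- (b ℤ.* c)) ⟨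
        ι (a ℤ.* d ℤ.- b ℤ.* c)                 ≈⟨ ι-cong det ⟩
        ι (+ 1)                                 ∎
      im-q : im (quot A τ) ≈ y * r
      im-q = begin
        im (quot A τ)
          ≈⟨ solve 5 (λ s t u v r →
               s :* (u :* con (+ 0) :+ (:- v) :* r) :+ t :* (u :* r :- (:- v) :* con (+ 0))
               := (t :* u :- s :* v) :* r) refl
               (re (num A τ)) (im (num A τ)) (re (j A τ)) (im (j A τ)) r ⟩
        (im (num A τ) * re (j A τ) - re (num A τ) * im (j A τ)) * r
          ≈⟨ *-congʳ (+-cong (*-cong (im-affine a b τ) (re-affine c d τ))
               (-‿cong (*-cong (re-affine a b τ) (im-affine c d τ)))) ⟩
        ((ι a * y) * (ι c * x + ι d) - (ι a * x + ι b) * (ι c * y)) * r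
          ≈⟨ solve 7 (λ a b c d x y r →
               ((a :* y) :* (c :* x :+ d) :- (a :* x :+ b) :* (c :* y)) :* r
               := (a :* d :- b :* c) :* (y :* r)) refl (ι a) (ι b) (ι c) (ι d) x y r ⟩
        (ι a * ι d - ι b * ι c) * (y * r)
          ≈⟨ *-congʳ det≈1 ⟩
        ι (+ 1) * (y * r)
          ≈⟨ solve 1 (λ s → con (+ 1) :* s := s) refl (y * r) ⟩
        y * r ∎

  abstract
    quot-im>0 : ∀ A τ → 0# < im (quot A τ)
    quot-im>0 A τ = <-respʳ-≈ (sym (quot-im A τ))
      (*-pos (ℋ.y>0 τ) (*-cancel-pos (j-normSq A τ) (proj₂ (N⁻¹ A τ))))

  infixr 7 _▷_

  _▷_ : SL₂ℤ → ℋ → ℋ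
  A ▷ τ = record { x = re (quot A τ) ; y = im (quot A τ) ; y>0 = quot-im>0 A τ }

module Exponential (𝓡 : RealField) where

  open RealField 𝓡 renaming (Carrier to ℝ)
  open RealExtras 𝓡
  open Complex 𝓡

  expSum : ℂ → ℕ → ℂ
  expSum z n = ∑[ k < n ] ((z ^ᶜ toℕ k) *ᶜ ofℝ (recip (toℕ k !) {{toℕ k !≢0}}))

  -- The fields determine exp and π uniquely: exp is the sum of its power
  -- series, and π is the least positive zero of the sine.

  record ExpPi : Set where
    field
      exp        : ℂ → ℂ
      exp-cong   : ∀ {z w} → z ≈ᶜ w → exp z ≈ᶜ exp w
      exp-series : ∀ z ε → 0# < ε →
        ∃[ N ] (∀ n → N ℕ.≤ n → normSq (expSum z n -ᶜ exp z) < ε * ε)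

    sin : ℝ → ℝ
    sin x = im (exp (𝕚 *ᶜ ofℝ x))

    field
      π       : ℝ
      π>0     : 0# < π
      sin-π   : sin π ≈ 0#
      π-least : ∀ x → 0# < x → x < π → sin x # 0#

    𝐞 : ℂ → ℂ
    𝐞 w = exp (ofℝ (ι (+ 2) * π) *ᶜ 𝕚 *ᶜ w)

module Theory (𝓡 : RealField) (𝓔 : Exponential.ExpPi 𝓡) where

  open RealField 𝓡 renaming (Carrier to ℝ)
  open RealExtras 𝓡
  open Complex 𝓡
  open Exponential.ExpPi 𝓔

  -- |f σ - f τ - D (σ - τ)| ≤ ε |σ - τ| near τ, with the norms squared.
  HasDifferential : (ℋ → ℂ) → ℋ → (ℂ → ℂ) → Set
  HasDifferential f τ D = ∀ ε → 0# < ε → ∃[ δ ] ((0# < δ) × (∀ σ →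
    let h = toℂ σ -ᶜ toℂ τ in normSq h < δ * δ →
    normSq ((f σ -ᶜ f τ) -ᶜ D h) ≤ (ε * ε) * normSq h))

  Holomorphic : (ℋ → ℂ) → Set
  Holomorphic f = ∀ τ → ∃[ d ] HasDifferential f τ (d *ᶜ_)

  Continuous : (ℋ → ℂ) → Set
  Continuous f = ∀ τ ε → 0# < ε → ∃[ δ ] ((0# < δ) × (∀ σ →
    normSq (toℂ σ -ᶜ toℂ τ) < δ * δ → normSq (f σ -ᶜ f τ) < ε * ε))

  IsC : ℕ → (ℋ → ℂ) → Set
  IsC zero    f = Continuous f
  IsC (suc k) f = Σ[ fx ∈ (ℋ → ℂ) ] Σ[ fy ∈ (ℋ → ℂ) ]
    (∀ τ → HasDifferential f τ (λ h → ofℝ (re h) *ᶜ fx τ +ᶜ ofℝ (im h) *ᶜ fy τ))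
    × IsC k fx × IsC k fy

  Smooth : (ℋ → ℂ) → Set
  Smooth f = ∀ k → IsC k f

  record Mp₂ℤ : Set where
    field
      mat     : SL₂ℤ
      φ       : ℋ → ℂ
      φ-cong  : ∀ {τ σ} → toℂ τ ≈ᶜ toℂ σ → φ τ ≈ᶜ φ σ
      φ-holo  : Holomorphic φ
      φ-sq    : ∀ τ → φ τ *ᶜ φ τ ≈ᶜ j mat τ

    abstract
      φ-inverse-* : ∀ τ → φ τ *ᶜ (φ τ *ᶜ Inverseᶜ.inv (j-inverse mat τ)) ≈ᶜ 1ᶜ
      φ-inverse-* τ = ℂR.trans (ℂR.sym (ℂR.*-assoc (φ τ) (φ τ) w))
        (ℂR.trans (ℂR.*-congʳ {w} (φ-sq τ)) inv-*)
        where open Inverseᶜ (j-inverse mat τ) renaming (inv to w)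

    φ-inverse : ∀ τ → Inverseᶜ (φ τ)
    φ-inverse τ = (φ τ *ᶜ Inverseᶜ.inv (j-inverse mat τ)) because φ-inverse-* τ

  open Mp₂ℤ using (mat; φ; φ-inverse)

  infix 4 _≈ᵐ_

  _≈ᵐ_ : Mp₂ℤ → Mp₂ℤ → Set
  g ≈ᵐ h = mat g ≈ˢ mat h × (∀ τ → φ g τ ≈ᶜ φ h τ)

  IsOne IsT IsS : Mp₂ℤ → Set
  IsOne g = mat g ≈ˢ 1ˢ × (∀ τ → φ g τ ≈ᶜ 1ᶜ)
  IsT   g = mat g ≈ˢ Tˢ × (∀ τ → φ g τ ≈ᶜ 1ᶜ)
  IsS   g = mat g ≈ˢ Sˢ × (∀ τ → 0# < im (φ g τ))

  -- k = g h. Stated as a relation, so that forming a product does not require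
  -- a proof that (φ ∘ B) ψ is holomorphic; likewise for IsTilde below.
  IsProduct : (g h k : Mp₂ℤ) → Set
  IsProduct g h k = mat k ≈ˢ mat g *ˢ mat h
                  × (∀ τ → φ k τ ≈ᶜ φ g (mat h ▷ τ) *ᶜ φ h τ)

  record Subgroup : Set₁ where
    infix 4 _∈ᴳ
    field
      _∈ᴳ        : Mp₂ℤ → Set
      resp       : ∀ {g h} → g ≈ᵐ h → g ∈ᴳ → h ∈ᴳ
      one-closed : ∀ {g} → IsOne g → g ∈ᴳ
      mul-closed : ∀ {g h k} → IsProduct g h k → g ∈ᴳ → h ∈ᴳ → k ∈ᴳ
      inv-closed : ∀ {g h k} → IsProduct g h k → IsOne k → g ∈ᴳ → h ∈ᴳ

  FiniteIndex : Subgroup → Set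
  FiniteIndex Γ = Σ[ N ∈ ℕ ] Σ[ r ∈ (Fin N → Mp₂ℤ) ]
    (∀ g → ∃[ i ] ∃[ h ] (h ∈ᴳ × IsProduct h (r i) g))
    where open Subgroup Γ

  -- g is the image of h under (A , φ) ↦ (Ã , φ̃).
  IsTilde : (h g : Mp₂ℤ) → Set
  IsTilde h g = (g′.a ≡ h′.a × g′.b ≡ ℤ.- h′.b × g′.c ≡ ℤ.- h′.c × g′.d ≡ h′.d)
              × (∀ τ → φ g τ ≈ᶜ conj (φ h (-conjᴴ τ)))
    where
    module g′ = SL₂ℤ (mat g)
    module h′ = SL₂ℤ (mat h)

  tilde : (Mp₂ℤ → Set) → (Mp₂ℤ → Set)
  tilde Γ g = ∃[ h ] (Γ h × IsTilde h g)

  record IsModularForm {N} (p q : ½ℤ) (ρ : Mp₂ℤ → Vector ℂ N → Vector ℂ N)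
                       (Γ : Mp₂ℤ → Set) (F : ℋ → Vector ℂ N) : Set where
    field
      cong    : ∀ {τ σ} → toℂ τ ≈ᶜ toℂ σ → ∀ i → F τ i ≈ᶜ F σ i
      smooth  : ∀ i → Smooth (λ τ → F τ i)
      modular : ∀ g → Γ g → ∀ τ i →
        F (mat g ▷ τ) i ≈ᶜ
          (zpow (φ g τ) (φ-inverse g τ) (½ℤ.twice p)
           *ᶜ zpow (conj (φ g τ)) (conj-inverse (φ g τ) (φ-inverse g τ)) (½ℤ.twice q))
          *ᶜ ρ g (F τ) i
      -- F(Aτ) = O(e^{Cy}) as y → ∞, uniformly for |x| < X
      growth  : ∀ A → ∃[ C ] (∀ X → ∃[ K ] ∃[ Y ] (∀ τ i →
        - X < ℋ.x τ → ℋ.x τ < X → Y < ℋ.y τ →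
        normSq (F (A ▷ τ) i) ≤ normSq (ofℝ K *ᶜ exp (ofℝ (C * ℋ.y τ)))))

  Lᴿ Lᶜ : EvenLattice → Set
  Lᴿ L = Vector ℝ (rank L)
  Lᶜ L = Vector ℂ (rank L)

  emb : ∀ {n} → LatVec n → Vector ℝ n
  emb m i = ι (lookup m i)

  pairᴿ : ∀ L → Lᴿ L → Lᴿ L → ℝ
  pairᴿ L = form (λ i j → ι (gram L i j))

  pairᶜ : ∀ L → Lᴿ L → Lᶜ L → ℂ
  pairᶜ L x ζ = RingExtras.form ℂ-commutativeRing (λ i j → ιᶜ (gram L i j)) (λ i → ofℝ (x i)) ζ

  -- An orthogonal family of vectors with nonzero squares is independent, so by
  -- rank≡ this is a diagonalization of the form with b₊ positive and b₋ negative entries.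
  record HasSignature (L : EvenLattice) (b₊ b₋ : ℕ) : Set where
    field
      rank≡ : b₊ ℕ.+ b₋ ≡ rank L
      pos   : Fin b₊ → Lᴿ L
      neg   : Fin b₋ → Lᴿ L
      pos>0 : ∀ i → 0# < pairᴿ L (pos i) (pos i)
      neg<0 : ∀ i → pairᴿ L (neg i) (neg i) < 0#
      pos⊥pos : ∀ i k → ¬ (i ≡ k) → pairᴿ L (pos i) (pos k) ≈ 0#
      neg⊥neg : ∀ i k → ¬ (i ≡ k) → pairᴿ L (neg i) (neg k) ≈ 0#
      pos⊥neg : ∀ i k → pairᴿ L (pos i) (neg k) ≈ 0#

  record Subspace (n : ℕ) : Set₁ where
    field
      _∈ⱽ      : Vector ℝ n → Set
      resp     : ∀ {x y} → (∀ i → x i ≈ y i) → x ∈ⱽ → y ∈ⱽ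
      0-closed : (λ _ → 0#) ∈ⱽ
      +-closed : ∀ {x y} → x ∈ⱽ → y ∈ⱽ → (λ i → x i + y i) ∈ⱽ
      ·-closed : ∀ r {x} → x ∈ⱽ → (λ i → r * x i) ∈ⱽ

  record Gr (L : EvenLattice) : Set₁ where
    field
      v₊ v₋ : Subspace (rank L)
    open Subspace v₊ public using () renaming (_∈ⱽ to _∈v₊)
    open Subspace v₋ public using () renaming (_∈ⱽ to _∈v₋)
    field
      orthogonal : ∀ {x y} → x ∈v₊ → y ∈v₋ → pairᴿ L x y ≈ 0#
      positive   : ∀ {x} → x ∈v₊ → ∀ i → x i # 0# → 0# < pairᴿ L x x
      negative   : ∀ {x} → x ∈v₋ → ∀ i → x i # 0# → pairᴿ L x x < 0#
      decompose  : ∀ x → Σ[ x₊ ∈ Lᴿ L ] Σ[ x₋ ∈ Lᴿ L ]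
        (x₊ ∈v₊ × x₋ ∈v₋ × (∀ i → x i ≈ x₊ i + x₋ i))

    proj₊ proj₋ : Lᴿ L → Lᴿ L
    proj₊ x = proj₁ (decompose x)
    proj₋ x = proj₁ (proj₂ (decompose x))

  ι-lookup-+ : ∀ {n} (x y : LatVec n) i → emb (x +ᴸ y) i ≈ emb x i + emb y i
  ι-lookup-+ x y i = trans (ι-cong (lookup-zipWith ℤ._+_ i x y)) (ι-+ (lookup x i) (lookup y i))

  ι-lookup-neg : ∀ {n} (x : LatVec n) i → emb (-ᴸ x) i ≈ - emb x i
  ι-lookup-neg x i = trans (ι-cong (lookup-map i (λ m → ℤ.- m) x)) (ι-neg (lookup x i))

  module _ (L : EvenLattice) (M : Sublattice (rank L)) where

    private module M = Sublattice M

    InDual : Lᴿ L → Set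
    InDual x = ∀ m → m M.∈ᴹ → ∃[ k ] (pairᴿ L x (emb m) ≈ ι k)

    Dual : Set
    Dual = Σ[ x ∈ Lᴿ L ] InDual x

    _≡ᴹ_ : Lᴿ L → Lᴿ L → Set
    x ≡ᴹ y = ∃[ m ] (m M.∈ᴹ × (∀ i → x i - y i ≈ ι (lookup m i)))

    private
      ≡ᴹ-refl : ∀ {x} → x ≡ᴹ x
      ≡ᴹ-refl {x} = 0ᴸ , M.0-closed , λ i →
        trans (-‿inverseʳ (x i)) (ι-cong (≡.sym (lookup-replicate i (+ 0))))

      ≡ᴹ-sym : ∀ {x y} → x ≡ᴹ y → y ≡ᴹ x
      ≡ᴹ-sym {x} {y} (m , m∈ , eq) = -ᴸ m , M.neg-closed m∈ , λ i →
        trans (solve 2 (λ a b → b :- a := :- (a :- b)) refl (x i) (y i))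
        (trans (-‿cong (eq i)) (sym (ι-lookup-neg m i)))

      ≡ᴹ-trans : ∀ {x y z} → x ≡ᴹ y → y ≡ᴹ z → x ≡ᴹ z
      ≡ᴹ-trans {x} {y} {z} (m , m∈ , p) (n , n∈ , q) = m +ᴸ n , M.+-closed m∈ n∈ , λ i →
        trans (solve 3 (λ a b c → a :- c := (a :- b) :+ (b :- c)) refl (x i) (y i) (z i))
        (trans (+-cong (p i) (q i)) (sym (ι-lookup-+ m n i)))

    D : Setoid 0ℓ 0ℓ
    D = record
      { Carrier       = Dual
      ; _≈_           = λ x y → proj₁ x ≡ᴹ proj₁ y
      ; isEquivalence = record
        { refl  = λ {x} → ≡ᴹ-refl {proj₁ x}
        ; sym   = λ {x} {y} → ≡ᴹ-sym {proj₁ x} {proj₁ y}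
        ; trans = λ {x} {y} {z} → ≡ᴹ-trans {proj₁ x} {proj₁ y} {proj₁ z}
        }
      }

  -- D_M = M*/M is finite: it is the image of Fin card under a bijection. Vectors
  -- in ℂ[D_M] are then families of coefficients indexed by Fin card.
  record Discriminant (L : EvenLattice) (M : Sublattice (rank L)) : Set where
    field
      card      : ℕ
      enumerate : Inverse (D L M) (≡.setoid (Fin card))
    open Inverse enumerate public
      using (inverseˡ; inverseʳ) renaming (to to class; from to representative)

    rep : Fin card → Lᴿ L
    rep γ = proj₁ (representative γ)

  open Discriminant using (card; rep)

  ℂ[_] : ∀ {L M} → Discriminant L M → Set
  ℂ[ 𝓓 ] = Vector ℂ (card 𝓓)

  indicator : {P : Set} → Dec P → ℂ
  indicator (yes _) = 1ᶜ
  indicator (no  _) = 0ᶜ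

  𝔢 : ∀ {n} → Fin n → Vector ℂ n
  𝔢 γ δ = indicator (γ ≟ᶠ δ)

  private
    pair-⟨-1⟩ : ∀ L x y → pairᴿ (L ⟨-1⟩) x y ≈ - pairᴿ L x y
    pair-⟨-1⟩ L x y = trans
      (form-cong (λ i j → ι-neg (gram L i j)) (λ _ → refl) (λ _ → refl))
      (form-negate (λ i j → ι (gram L i j)) x y)

    to-⟨-1⟩ : ∀ L M {x} → InDual L M x → InDual (L ⟨-1⟩) M x
    to-⟨-1⟩ L M {x} x∈ m m∈ with x∈ m m∈
    ... | k , eq = ℤ.- k , trans (pair-⟨-1⟩ L x (emb m)) (trans (-‿cong eq) (sym (ι-neg k)))

    from-⟨-1⟩ : ∀ L M {x} → InDual (L ⟨-1⟩) M x → InDual L M x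
    from-⟨-1⟩ L M {x} x∈ m m∈ with x∈ m m∈
    ... | k , eq = ℤ.- k , trans
      (solve 1 (λ a → a := :- (:- a)) refl (pairᴿ L x (emb m)))
      (trans (-‿cong (trans (sym (pair-⟨-1⟩ L x (emb m))) eq)) (sym (ι-neg k)))

  infix 9 _⟨-1⟩ᴰ

  _⟨-1⟩ᴰ : ∀ {L M} → Discriminant L M → Discriminant (L ⟨-1⟩) M
  _⟨-1⟩ᴰ {L} {M} 𝓓 = record
    { card      = card 𝓓
    ; enumerate = record
      { to        = λ x → to (proj₁ x , from-⟨-1⟩ L M (proj₂ x))
      ; from      = λ γ → proj₁ (from γ) , to-⟨-1⟩ L M (proj₂ (from γ))
      ; to-cong   = λ {x} {y} x≡y →
          to-cong {proj₁ x , from-⟨-1⟩ L M (proj₂ x)} {proj₁ y , from-⟨-1⟩ L M (proj₂ y)} x≡y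
      ; from-cong = from-cong
      ; inverse   = (λ {γ} {x} x≡ → inverseˡ {γ} {proj₁ x , from-⟨-1⟩ L M (proj₂ x)} x≡)
                  , (λ {x} {γ} γ≡ → inverseʳ {proj₁ x , from-⟨-1⟩ L M (proj₂ x)} {γ} γ≡)
      }
    }
    where open Inverse (Discriminant.enumerate 𝓓)

  -- 𝔢 γ, seen in ℂ[ 𝓓 ⟨-1⟩ᴰ ], is the dual basis vector 𝔢*_γ.
  pairing : ∀ {L M} (𝓓 : Discriminant L M) → ℂ[ 𝓓 ] → ℂ[ 𝓓 ⟨-1⟩ᴰ ] → ℂ
  pairing 𝓓 U V = ∑[ γ < card 𝓓 ] (U γ *ᶜ V γ)

  ω : ∀ {L M} (𝓓 : Discriminant L M) → ℂ[ 𝓓 ] → ℂ[ 𝓓 ⟨-1⟩ᴰ ]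
  ω 𝓓 U δ = ∑[ γ < card 𝓓 ] (U γ *ᶜ 𝔢 γ δ)

  module Arrow {L : EvenLattice} {Λ : Sublattice (rank L)}
               (𝓓ᴸ : Discriminant L whole) (𝓓ᴧ : Discriminant L Λ) where

    private
      module DL = Discriminant 𝓓ᴸ
      module DΛ = Discriminant 𝓓ᴧ
      module Λ = Sublattice Λ

    -- δ ∈ H^⊥ = L*/Λ, and δ + H = γ.
    LiesOver : Fin DL.card → Fin DΛ.card → Set
    LiesOver γ δ = Σ[ δ∈L* ∈ InDual L whole (DΛ.rep δ) ] (DL.class (DΛ.rep δ , δ∈L*) ≡ γ)

    private
      InDual-resp : ∀ {x y} → (∀ i → x i ≈ y i) → InDual L whole x → InDual L whole y
      InDual-resp x≈y x∈ m _ with x∈ m tt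
      ... | k , eq = k , trans (form-cong (λ _ _ → refl) (λ i → sym (x≈y i)) (λ _ → refl)) eq

      InDual-+-emb : ∀ {x} → InDual L whole x → ∀ n → InDual L whole (λ i → x i + emb n i)
      InDual-+-emb {x} x∈ n m _ with x∈ m tt
      ... | k , eq = k ℤ.+ EvenLattice.⟪_,_⟫ L n m ,
        trans (form-+ˡ (λ i j → ι (gram L i j)) x (emb n) (emb m))
        (trans (+-cong eq (sym (ι-form commutativeRing (gram L) (lookup n) (lookup m))))
        (sym (ι-+ k (EvenLattice.⟪_,_⟫ L n m))))

      weaken : ∀ {x} → InDual L whole x → InDual L Λ x
      weaken x∈ m _ = x∈ m tt

      point : Fin DL.card → Fin Λ.cosets → Lᴿ L
      point γ h i = DL.rep γ i + emb (Λ.coset h) i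

      point∈ : ∀ γ h → InDual L whole (point γ h)
      point∈ γ h = InDual-+-emb (proj₂ (DL.representative γ)) (Λ.coset h)

      Hit : Fin DL.card → Fin DΛ.card → Fin Λ.cosets → Set
      Hit γ δ h = DΛ.class (point γ h , weaken (point∈ γ h)) ≡ δ

      hit⇒over : ∀ γ δ h → Hit γ δ h → LiesOver γ δ
      hit⇒over γ δ h hit = found (DΛ.inverseʳ {point γ h , weaken (point∈ γ h)} {δ} (≡.sym hit))
        where
        found : _≡ᴹ_ L Λ (DΛ.rep δ) (point γ h) → LiesOver γ δ
        found (m , _ , eq) = δ∈ , DL.inverseˡ {γ} {DΛ.rep δ , δ∈}
          (Λ.coset h +ᴸ m , tt , λ i →
            trans (solve 3 (λ d g c → d :- g := c :+ (d :- (g :+ c))) refl (DΛ.rep δ i) (DL.rep γ i) (emb (Λ.coset h) i))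
            (trans (+-congˡ (eq i)) (sym (ι-lookup-+ (Λ.coset h) m i))))
          where
          δ∈ : InDual L whole (DΛ.rep δ)
          δ∈ = InDual-resp (λ i → trans (+-congˡ (sym (eq i)))
            (solve 2 (λ p d → p :+ (d :- p) := d) refl (point γ h i) (DΛ.rep δ i)))
            (InDual-+-emb (point∈ γ h) m)

      over⇒hit : ∀ γ δ → LiesOver γ δ → ∃[ h ] Hit γ δ h
      over⇒hit γ δ (δ∈ , cls) = found (DL.inverseʳ {DΛ.rep δ , δ∈} {γ} (≡.sym cls))
        where
        found : _≡ᴹ_ L whole (DL.rep γ) (DΛ.rep δ) → ∃[ h ] Hit γ δ h
        found (m , _ , eq) = h , DΛ.inverseˡ {δ} {point γ h , weaken (point∈ γ h)}
          (-ᴸ (-ᴸ m +ᴸ -ᴸ c) , Λ.neg-closed (proj₂ (Λ.covered (-ᴸ m))) , λ i →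
            trans (solve 3 (λ g c d → (g :+ c) :- d := :- (:- (g :- d) :+ :- c)) refl (DL.rep γ i) (emb c i) (DΛ.rep δ i))
            (trans (-‿cong (+-cong (trans (-‿cong (eq i)) (sym (ι-lookup-neg m i))) (sym (ι-lookup-neg c i))))
            (trans (-‿cong (sym (ι-lookup-+ (-ᴸ m) (-ᴸ c) i))) (sym (ι-lookup-neg (-ᴸ m +ᴸ -ᴸ c) i)))))
          where
          h = proj₁ (Λ.covered (-ᴸ m))
          c = Λ.coset h

    abstract
      liesOver? : ∀ γ δ → Dec (LiesOver γ δ)
      liesOver? γ δ = map′ (λ (h , hit) → hit⇒over γ δ h hit) (over⇒hit γ δ)
        (any? (λ h → DΛ.class (point γ h , weaken (point∈ γ h)) ≟ᶠ δ))

    ↑𝔢 : Fin DL.card → ℂ[ 𝓓ᴧ ]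
    ↑𝔢 γ δ = indicator (liesOver? γ δ)

    ↑ : ℂ[ 𝓓ᴸ ] → ℂ[ 𝓓ᴧ ]
    ↑ U δ = ∑[ γ < DL.card ] (U γ *ᶜ ↑𝔢 γ δ)

  record IsWeilRepresentation {L : EvenLattice} (𝓓 : Discriminant L whole) (b₊ b₋ : ℕ)
                              (ρ : Mp₂ℤ → ℂ[ 𝓓 ] → ℂ[ 𝓓 ]) : Set where
    field
      cong   : ∀ {g h U V} → g ≈ᵐ h → (∀ δ → U δ ≈ᶜ V δ) → ∀ δ → ρ g U δ ≈ᶜ ρ h V δ
      +-homo : ∀ g U V δ → ρ g (λ γ → U γ +ᶜ V γ) δ ≈ᶜ ρ g U δ +ᶜ ρ g V δ
      ·-homo : ∀ g z U δ → ρ g (λ γ → z *ᶜ U γ) δ ≈ᶜ z *ᶜ ρ g U δ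
      one    : ∀ {g} → IsOne g → ∀ U δ → ρ g U δ ≈ᶜ U δ
      mul    : ∀ {g h k} → IsProduct g h k → ∀ U δ → ρ k U δ ≈ᶜ ρ g (ρ h U) δ
      ρ-T    : ∀ {g} → IsT g → ∀ γ δ →
        ρ g (𝔢 γ) δ ≈ᶜ 𝐞 (ofℝ (pairᴿ L (rep 𝓓 γ) (rep 𝓓 γ) * recip 2)) *ᶜ 𝔢 γ δ
      -- r = 1 / √|D_L|
      ρ-S    : ∀ {g} → IsS g → ∀ r → 0# < r → (r * r) * ι (+ card 𝓓) ≈ 1# → ∀ γ δ →
        ρ g (𝔢 γ) δ ≈ᶜ
          (𝐞 (ofℝ (ι (+ b₋ ℤ.- + b₊) * recip 8)) *ᶜ ofℝ r)
          *ᶜ (∑[ β < card 𝓓 ] (𝐞 (ofℝ (- pairᴿ L (rep 𝓓 γ) (rep 𝓓 β))) *ᶜ 𝔢 β δ))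

  sumList : ∀ {I : Set} → (I → ℂ) → List I → ℂ
  sumList f = foldr (λ i z → f i +ᶜ z) 0ᶜ

  -- Unconditional convergence of Σ f i over the i satisfying P: partial sums over
  -- finite sets, given as duplicate-free lists, converge along inclusion.
  HasSum : {I : Set} (P : I → Set) → (I → ℂ) → ℂ → Set
  HasSum {I} P f s = ∀ ε → 0# < ε → Σ[ S ∈ List I ] (All P S × (∀ S′ →
    Unique S′ → All P S′ → S ⊆ S′ → normSq (sumList f S′ -ᶜ s) < ε * ε))

  module _ {L : EvenLattice} (v : Gr L) where

    open Gr v

    thetaTerm : ℋ → Lᶜ L → Lᴿ L → ℂ
    thetaTerm τ ζ x = 𝐞 (toℂ τ *ᶜ ofℝ (pairᴿ L (proj₊ x) (proj₊ x) * recip 2)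
                      +ᶜ conj (toℂ τ) *ᶜ ofℝ (pairᴿ L (proj₋ x) (proj₋ x) * recip 2)
                      +ᶜ pairᶜ L x ζ)

    -- Θ is the Jacobi–Siegel theta function of M: its γ component is the sum of
    -- the series over M + γ, which m ↦ rep γ + m parametrizes by M.
    IsTheta : {M : Sublattice (rank L)} (𝓓 : Discriminant L M) → (ℋ → Lᶜ L → ℂ[ 𝓓 ]) → Set
    IsTheta {M} 𝓓 Θ = ∀ τ ζ γ →
      HasSum (Sublattice._∈ᴹ M) (λ m → thetaTerm τ ζ (λ i → rep 𝓓 γ i + emb m i)) (Θ τ ζ γ)

  -- Φ and Φ̃, in terms of the theta function Θ entering them.
  module _ {L : EvenLattice} {M : Sublattice (rank L)} (𝓓 : Discriminant L M)
           (Θ : ℋ → Lᶜ L → ℂ[ 𝓓 ]) where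

    Φ : (ℋ → ℂ[ 𝓓 ⟨-1⟩ᴰ ]) → ℋ → Lᶜ L → ℂ
    Φ F τ ζ = pairing 𝓓 (Θ τ ζ) (F τ)

    Φ̃ : (ℋ → ℂ[ 𝓓 ]) → ℋ → Lᶜ L → ℂ
    Φ̃ G = Φ (λ τ → ω 𝓓 (G (-conjᴴ τ)))

{-# OPTIONS --safe #-}
module Submission where

-- As Λ* ⊇ L*, each coset γ + L splits into the cosets δ + Λ with δ over γ, so
-- Θ_{L,γ} = Σ_δ Θ_{Λ,δ} ↑(γ,δ): the arrow on F is the transpose of this splitting
-- of the theta function. For Φ̃ it remains that ω is the identity on coefficients.
-- Unconditional sums may be rearranged constructively because membership of
-- m ∈ ℤⁿ in the part of δ is decided by the class of γ + m in D_Λ.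

open import Algebra.Bundles using (CommutativeRing)
open import Defs
open import Data.Empty using (⊥-elim)
open import Data.Fin.Base using (Fin; zero; suc)
open import Data.Fin.Properties using (suc-injective) renaming (_≟_ to _≟ᶠ_)
open import Data.Integer.Base as ℤ using (ℤ; +_)
import Data.Integer.Properties as ℤ
open import Data.List.Base using (List; []; _∷_; _++_; map; filter; concat; tabulate; deduplicate)
open import Data.List.Membership.Propositional using (_∈_)
open import Data.List.Membership.Propositional.Properties
  using (∈-map⁺; ∈-++⁺ˡ; ∈-++⁺ʳ; ∈-concat⁺′; ∈-tabulate⁺; ∈-filter⁺; ∈-deduplicate⁺)
open import Data.List.Relation.Binary.Subset.Propositional using (_⊆_)
open import Data.List.Relation.Unary.All as All using (All; []; _∷_)
import Data.List.Relation.Unary.All.Properties as All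
open import Data.List.Relation.Unary.Unique.Propositional using (Unique)
import Data.List.Relation.Unary.Unique.Propositional.Properties as Unique
import Data.List.Relation.Unary.Unique.DecPropositional.Properties as DecUnique
open import Data.Nat.Base using (ℕ)
open import Data.Product.Base using (Σ-syntax; ∃-syntax; _×_; _,_; proj₁; proj₂)
open import Data.Sum.Base using (_⊎_; inj₁; inj₂)
open import Data.Unit.Base using (⊤; tt)
open import Data.Vec.Base using ([]; _∷_; lookup)
open import Data.Vec.Functional using (Vector)
open import Data.Vec.Properties
  using (≡-dec; zipWith-assoc; zipWith-identityʳ; zipWith-inverseˡ; zipWith-inverseʳ)
open import Function.Base using (_∘_)
open import Relation.Binary.Bundles using (Setoid)
open import Relation.Binary.Definitions using (DecidableEquality)
open import Relation.Binary.PropositionalEquality.Core as ≡ using (_≡_)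
open import Relation.Binary.Structures using (IsStrictPartialOrder)
open import Relation.Nullary.Decidable using (Dec; yes; no; map′)
open import Relation.Nullary.Negation using (¬_)

open EvenLattice using (rank; gram)

-- Cancellation in ℤⁿ.

lookup-injective : ∀ {n} {x y : LatVec n} → (∀ i → lookup x i ≡ lookup y i) → x ≡ y
lookup-injective {x = []}    {[]}    eq = ≡.refl
lookup-injective {x = _ ∷ _} {_ ∷ _} eq =
  ≡.cong₂ _∷_ (eq zero) (lookup-injective (λ i → eq (suc i)))

+ᴸ-cancel-neg : ∀ {n} (m s : LatVec n) → (m +ᴸ s) +ᴸ (-ᴸ s) ≡ m
+ᴸ-cancel-neg m s = ≡.trans (zipWith-assoc ℤ.+-assoc m s (-ᴸ s))
  (≡.trans (≡.cong (m +ᴸ_) (zipWith-inverseʳ ℤ.+-inverseʳ s)) (zipWith-identityʳ ℤ.+-identityʳ m))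

neg-+ᴸ-cancel : ∀ {n} (m s : LatVec n) → (m +ᴸ (-ᴸ s)) +ᴸ s ≡ m
neg-+ᴸ-cancel m s = ≡.trans (zipWith-assoc ℤ.+-assoc m (-ᴸ s) s)
  (≡.trans (≡.cong (m +ᴸ_) (zipWith-inverseˡ ℤ.+-inverseˡ s)) (zipWith-identityʳ ℤ.+-identityʳ m))

-- Strict inequalities and approximation in the real field.

module OrderedField (𝓡 : RealField) where

  open RealField 𝓡 renaming (Carrier to ℝ)
  open RealExtras 𝓡
  open IsStrictPartialOrder isStrictPartialOrder
    using (<-respʳ-≈; <-respˡ-≈; irrefl; asym) renaming (trans to <-trans)
  open import Relation.Binary.Reasoning.Setoid (CommutativeRing.setoid commutativeRing)

  <-resp : ∀ {x x′ y y′} → x ≈ x′ → y ≈ y′ → x < y → x′ < y′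
  <-resp p q r = <-respʳ-≈ q (<-respˡ-≈ p r)

  ≈-of-¬# : ∀ {x y} → ¬ (x # y) → x ≈ y
  ≈-of-¬# = proj₁ (tight _ _)

  +-mono-< : ∀ {a b c d} → a < b → c < d → a + c < b + d
  +-mono-< {b = b} {c} a<b c<d =
    <-trans (+-monoˡ-< c a<b) (<-resp (+-comm _ b) (+-comm _ b) (+-monoˡ-< b c<d))

  x<y⇒0<y-x : ∀ {x y} → x < y → 0# < y - x
  x<y⇒0<y-x {x} x<y = <-respˡ-≈ (-‿inverseʳ x) (+-monoˡ-< (- x) x<y)

  0<y-x⇒x<y : ∀ {x y} → 0# < y - x → x < y
  0<y-x⇒x<y {x} {y} p = <-resp (+-identityˡ x)
    (solve 2 (λ a b → (b :- a) :+ a := b) refl x y) (+-monoˡ-< x p)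

  -- `x ≤ y` only refutes `y < x`, so the order comes from cotransitivity: `x` is apart from `y` or
  -- from `z`, and in both cases the wrong order is refuted.
  ≤-<-trans : ∀ {x y z} → x ≤ y → y < z → x < z
  ≤-<-trans {x} {y} x≤y y<z with #-cotrans (<⇒# y<z) x
  ... | inj₁ y#x with #⇒<⊎> y#x
  ...   | inj₁ y<x = ⊥-elim (x≤y y<x)
  ...   | inj₂ x<y = <-trans x<y y<z
  ≤-<-trans {x} {y} x≤y y<z | inj₂ x#z with #⇒<⊎> x#z
  ...   | inj₁ x<z = x<z
  ...   | inj₂ z<x = ⊥-elim (x≤y (<-trans y<z z<x))

  -- `ε - a` is a factor of the positive number ε² - a², so it is apart from 0 and has a sign; the
  -- negative sign would give `ε < a` and then ε² < a².
  sq<⇒< : ∀ {a ε} → 0# < ε → a * a < ε * ε → a < ε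
  sq<⇒< {a} {ε} 0<ε a²<ε² = cases (#⇒<⊎> (x*y#0⇒x#0 (#-sym (<⇒# 0<product))))
    where
    0<product : 0# < (ε - a) * (ε + a)
    0<product = <-respʳ-≈ (solve 2 (λ a e → e :* e :- a :* a := (e :- a) :* (e :+ a)) refl a ε)
      (x<y⇒0<y-x a²<ε²)
    ε≮a : ¬ (ε < a)
    ε≮a ε<a = asym a²<ε² (0<y-x⇒x<y
      (<-respʳ-≈ (solve 2 (λ a e → (a :- e) :* (a :+ e) := a :* a :- e :* e) refl a ε)
        (*-pos (x<y⇒0<y-x ε<a) (<-respˡ-≈ (+-identityˡ 0#) (+-mono-< (<-trans 0<ε ε<a) 0<ε)))))
    cases : ε - a < 0# ⊎ 0# < ε - a → a < ε
    cases (inj₂ 0<ε-a) = 0<y-x⇒x<y 0<ε-a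
    cases (inj₁ ε-a<0) = ⊥-elim (ε≮a (<-resp
      (solve 2 (λ a e → (e :- a) :+ a := e) refl a ε) (+-identityˡ a) (+-monoˡ-< a ε-a<0)))

  sq-sum<⇒< : ∀ {a b ε} → 0# < ε → a * a + b * b < ε * ε → a < ε
  sq-sum<⇒< {a} {b} {ε} 0<ε p = sq<⇒< 0<ε (≤-<-trans a²≤ p)
    where
    a²≤ : a * a ≤ a * a + b * b
    a²≤ q = sq-nonneg b (<-resp
      (solve 2 (λ x y → (x :+ y) :- x := y) refl (a * a) (b * b)) (-‿inverseʳ (a * a))
      (+-monoˡ-< (- (a * a)) q))

  sq-sum<⇒Within : ∀ {x y b ε} → 0# < ε → (x - y) * (x - y) + b * b < ε * ε → Within ε x y
  sq-sum<⇒Within {x} {y} {b} 0<ε p = sq-sum<⇒< 0<ε p , sq-sum<⇒< 0<ε (<-respˡ-≈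
    (+-congʳ (solve 2 (λ x y → (x :- y) :* (x :- y) := (y :- x) :* (y :- x)) refl x y)) p)

  Within-sym : ∀ {ε x y} → Within ε x y → Within ε y x
  Within-sym (p , q) = q , p

  Within-cong : ∀ {ε ε′ x x′ y y′} → ε ≈ ε′ → x ≈ x′ → y ≈ y′ → Within ε x y → Within ε′ x′ y′
  Within-cong e p q (r , s) =
    <-resp (+-cong p (-‿cong q)) e r , <-resp (+-cong q (-‿cong p)) e s

  Within-refl : ∀ {ε x} → 0# < ε → Within ε x x
  Within-refl {x = x} 0<ε = <-respˡ-≈ (sym (-‿inverseʳ x)) 0<ε , <-respˡ-≈ (sym (-‿inverseʳ x)) 0<ε

  Within-trans : ∀ {ε η x y z} → Within ε x y → Within η y z → Within (ε + η) x z
  Within-trans {x = x} {y} {z} (p , p′) (q , q′) =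
    <-respˡ-≈ (solve 3 (λ x y z → (x :- y) :+ (y :- z) := x :- z) refl x y z) (+-mono-< p q) ,
    <-respˡ-≈ (solve 3 (λ x y z → (y :- x) :+ (z :- y) := z :- x) refl x y z) (+-mono-< p′ q′)

  Within-+ : ∀ {ε η x y z w} → Within ε x y → Within η z w → Within (ε + η) (x + z) (y + w)
  Within-+ {x = x} {y} {z} {w} (p , p′) (q , q′) =
    <-respˡ-≈ (rearrange x y z w) (+-mono-< p q) , <-respˡ-≈ (rearrange y x w z) (+-mono-< p′ q′)
    where
    rearrange : ∀ x y z w → (x - y) + (z - w) ≈ (x + z) - (y + w)
    rearrange = solve 4 (λ x y z w → (x :- y) :+ (z :- w) := (x :+ z) :- (y :+ w)) refl

  -- If `x` and `y` were apart, their distance would be a legitimate ε and so be smaller than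
  -- itself; tightness then gives equality.
  ≈-of-Within : ∀ {x y} → (∀ ε → 0# < ε → Within ε x y) → x ≈ y
  ≈-of-Within close = ≈-of-¬# λ x#y → case (#⇒<⊎> x#y)
    where
    case : _ ⊎ _ → _
    case (inj₁ x<y) = irrefl refl (proj₂ (close _ (x<y⇒0<y-x x<y)))
    case (inj₂ y<x) = irrefl refl (proj₁ (close _ (x<y⇒0<y-x y<x)))

  _÷suc_ : ∀ {ε} → 0# < ε → ∀ n → ∃[ η ] (0# < η × ι (+ ℕ.suc n) * η ≈ ε)
  _÷suc_ {ε} 0<ε n with inverse (#-sym (<⇒# (ι-pos n)))
  ... | r , ιr≈1 = r * ε , *-pos (*-cancel-pos (ι-pos n) ιr≈1) 0<ε ,
    trans (sym (*-assoc _ r ε)) (trans (*-congʳ ιr≈1) (*-identityˡ ε))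

  ι-suc-* : ∀ n η → η + ι (+ n) * η ≈ ι (+ ℕ.suc n) * η
  ι-suc-* n η = sym (trans (distribʳ η 1# (ι (+ n))) (+-congʳ (*-identityˡ η)))

  -- Distinct integers differ by a nonzero integer, whose image is apart from 0 because an ordered
  -- field has characteristic 0.
  ι-injective : ∀ {i j} → ι i ≈ ι j → i ≡ j
  ι-injective {i} {j} ιi≈ιj with i ℤ.≟ j
  ... | yes i≡j = i≡j
  ... | no  i≢j = ⊥-elim (#-irrefl ι≈0 (ι-#0 (i ℤ.- j) (i≢j ∘ ℤ.i-j≡0⇒i≡j i j)))
    where
    ι≈0 : ι (i ℤ.- j) ≈ 0#
    ι≈0 = begin
      ι (i ℤ.- j)          ≈⟨ ι-+ i (ℤ.- j) ⟩
      ι i + ι (ℤ.- j)      ≈⟨ +-cong ιi≈ιj (ι-neg j) ⟩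
      ι j - ι j            ≈⟨ -‿inverseʳ _ ⟩
      0#                   ∎

-- Finite and unconditional sums of complex numbers.

module Summation (𝓡 : RealField) (𝓔 : Exponential.ExpPi 𝓡) where

  open RealField 𝓡 renaming (Carrier to ℝ)
  open RealExtras 𝓡
  open OrderedField 𝓡
  open IsStrictPartialOrder isStrictPartialOrder using (<-respˡ-≈)
  open Complex 𝓡
  open Theory 𝓡 𝓔
  open import Algebra.Properties.Semiring.Sum ℂR.semiring
    using (sum-cong-≋; ∑-distrib-+; ∑-comm; *-distribˡ-sum; *-distribʳ-sum; sum-replicate-zero)
  open import Relation.Binary.Reasoning.Setoid ℂR.setoid

  Close : ℝ → ℂ → ℂ → Set
  Close ε z w = Within ε (re z) (re w) × Within ε (im z) (im w)

  Close-cong : ∀ {ε ε′ z z′ w w′} → ε ≈ ε′ → z ≈ᶜ z′ → w ≈ᶜ w′ → Close ε z w → Close ε′ z′ w′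
  Close-cong e p q (c , d) = Within-cong e (re≈ p) (re≈ q) c , Within-cong e (im≈ p) (im≈ q) d

  normSq<⇒Close : ∀ {ε z w} → 0# < ε → normSq (z -ᶜ w) < ε * ε → Close ε z w
  normSq<⇒Close 0<ε p = sq-sum<⇒Within 0<ε p , sq-sum<⇒Within 0<ε (<-respˡ-≈ (+-comm _ _) p)

  -- The bound counts one more `η` than there are terms, since the strict inequality needs a
  -- positive error for the empty sum too.
  Close-∑ : ∀ {η} → 0# < η → ∀ {n} {z w : Vector ℂ n} → (∀ i → Close η (z i) (w i)) →
    Close (ι (+ ℕ.suc n) * η) (∑[ i < n ] z i) (∑[ i < n ] w i)
  Close-∑ {η} 0<η {ℕ.zero} _ = Within-refl 0<1η , Within-refl 0<1η
    where 0<1η = *-pos (ι-pos 0) 0<η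
  Close-∑ {η} 0<η {ℕ.suc n} close = Close-cong (ι-suc-* (ℕ.suc n) η) ℂR.refl ℂR.refl
    (Within-+ (proj₁ (close zero)) (proj₁ rest) , Within-+ (proj₂ (close zero)) (proj₂ rest))
    where rest = Close-∑ 0<η (λ i → close (suc i))

  -- HasSum with the squared modulus replaced by the two coordinates, so that errors add up.
  SumsTo : {I : Set} → (I → Set) → (I → ℂ) → ℂ → Set
  SumsTo {I} P f s = ∀ ε → 0# < ε → Σ[ S ∈ List I ] (All P S × (∀ S′ →
    Unique S′ → All P S′ → S ⊆ S′ → Close ε (sumList f S′) s))

  HasSum⇒SumsTo : ∀ {I : Set} {P : I → Set} {f s} → HasSum P f s → SumsTo P f s
  HasSum⇒SumsTo h ε 0<ε with h ε 0<ε
  ... | S , PS , close = S , PS , λ S′ u P′ S⊆ → normSq<⇒Close 0<ε (close S′ u P′ S⊆)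

  sumList-map : ∀ {I J : Set} {f : I → ℂ} {g : J → ℂ} (φ : I → J) → (∀ i → g (φ i) ≈ᶜ f i) →
    ∀ S → sumList g (map φ S) ≈ᶜ sumList f S
  sumList-map φ eq []      = ℂR.refl
  sumList-map φ eq (i ∷ S) = ℂR.+-cong (eq i) (sumList-map φ eq S)

  SumsTo-∅ : ∀ {I : Set} {P : I → Set} {f} → (∀ i → ¬ P i) → SumsTo P f 0ᶜ
  SumsTo-∅ {P = P} {f} ¬P ε 0<ε = [] , [] , λ S′ _ PS′ _ → close S′ PS′
    where
    close : ∀ S′ → All P S′ → Close ε (sumList f S′) 0ᶜ
    close []      _        = Within-refl 0<ε , Within-refl 0<ε
    close (i ∷ _) (Pi ∷ _) = ⊥-elim (¬P i Pi)

  SumsTo-congˢ : ∀ {I : Set} {P : I → Set} {f s t} → s ≈ᶜ t → SumsTo P f s → SumsTo P f t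
  SumsTo-congˢ s≈t h ε 0<ε with h ε 0<ε
  ... | S , PS , close = S , PS , λ S′ u P′ S⊆ → Close-cong refl ℂR.refl s≈t (close S′ u P′ S⊆)

  -- A finite set that works for `f` is carried over by `φ`. A larger duplicate-free list is pulled
  -- back by `ψ`: it stays duplicate-free by injectivity and keeps its sum.
  SumsTo-reindex : ∀ {I J : Set} {P : I → Set} {Q : J → Set} {f g s} (φ : I → J) (ψ : J → I) →
    (∀ i → ψ (φ i) ≡ i) → (∀ j → φ (ψ j) ≡ j) →
    (∀ {i} → P i → Q (φ i)) → (∀ {j} → Q j → P (ψ j)) → (∀ i → g (φ i) ≈ᶜ f i) →
    SumsTo P f s → SumsTo Q g s
  SumsTo-reindex {f = f} {g} φ ψ ψφ φψ P⇒Q Q⇒P g∘φ≈f h ε 0<ε with h ε 0<ε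
  ... | S , PS , close = map φ S , All.map⁺ (All.map P⇒Q PS) , λ S′ u QS′ φS⊆S′ →
    Close-cong refl
      (sumList-map ψ (λ j → ℂR.trans (ℂR.sym (g∘φ≈f (ψ j))) (ℂR.reflexive (≡.cong g (φψ j)))) S′)
      ℂR.refl
      (close (map ψ S′) (Unique.map⁺ ψ-injective u) (All.map⁺ (All.map Q⇒P QS′))
        (λ {i} i∈S → ≡.subst (_∈ map ψ S′) (ψφ i) (∈-map⁺ ψ (φS⊆S′ (∈-map⁺ φ i∈S)))))
    where
    ψ-injective : ∀ {j k} → ψ j ≡ ψ k → j ≡ k
    ψ-injective {j} {k} eq = ≡.trans (≡.sym (φψ j)) (≡.trans (≡.cong φ eq) (φψ k))

  -- Both sums are tested on one finite set, the union of the two witnesses; decidable equality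
  -- serves to remove its duplicates.
  SumsTo-unique : ∀ {I : Set} → DecidableEquality I → ∀ {f : I → ℂ} {s t} →
    SumsTo (λ _ → ⊤) f s → SumsTo (λ _ → ⊤) f t → s ≈ᶜ t
  SumsTo-unique _≟_ {f} {s} {t} hs ht = ≈-of-Within (λ ε 0<ε → proj₁ (close ε 0<ε))
                                     ,ᶜ ≈-of-Within (λ ε 0<ε → proj₂ (close ε 0<ε))
    where
    close : ∀ ε → 0# < ε → Close ε s t
    -- Half of `ε` for each of the two sums.
    close ε 0<ε with 0<ε ÷suc 1
    ... | η , 0<η , 2η≈ε with hs η 0<η | ht η 0<η
    ... | S , _ , near-s | T , _ , near-t = Close-cong
      (trans (solve 1 (λ η → η :+ η := con (+ 2) :* η) refl η) 2η≈ε) ℂR.refl ℂR.refl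
      (Within-trans (Within-sym (proj₁ s~)) (proj₁ t~) , Within-trans (Within-sym (proj₂ s~)) (proj₂ t~))
      where
      U = deduplicate _≟_ (S ++ T)
      all : All (λ _ → ⊤) U
      all = All.universal (λ _ → tt) U
      s~ = near-s U (DecUnique.deduplicate-! _≟_ (S ++ T)) all (∈-deduplicate⁺ _≟_ ∘ ∈-++⁺ˡ)
      t~ = near-t U (DecUnique.deduplicate-! _≟_ (S ++ T)) all (∈-deduplicate⁺ _≟_ ∘ ∈-++⁺ʳ S)

  -- Indicator values as coefficients.

  indicator-yes : ∀ {P : Set} (P? : Dec P) → P → indicator P? ≈ᶜ 1ᶜ
  indicator-yes (yes _) _ = ℂR.refl
  indicator-yes (no ¬p) p = ⊥-elim (¬p p)

  indicator-no : ∀ {P : Set} (P? : Dec P) → ¬ P → indicator P? ≈ᶜ 0ᶜ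
  indicator-no (yes p) ¬p = ⊥-elim (¬p p)
  indicator-no (no _)  _  = ℂR.refl

  -- Fixes a 0/1 value by the condition alone. The arrows for L and L(-1) use different decision
  -- procedures, and this lets one argument treat both.
  record Indicates (P : Set) (z : ℂ) : Set where
    field
      true  : P → z ≈ᶜ 1ᶜ
      false : ¬ P → z ≈ᶜ 0ᶜ

  ∑-zero : ∀ {n} {U : Vector ℂ n} → (∀ i → U i ≈ᶜ 0ᶜ) → ∑[ i < n ] U i ≈ᶜ 0ᶜ
  ∑-zero {n} U≈0 = ℂR.trans (sum-cong-≋ U≈0) (sum-replicate-zero n)

  ∑-indicator : ∀ {n} {P : Fin n → Set} (P? : ∀ i → Dec (P i)) δ → P δ →
    (∀ {i} → P i → i ≡ δ) → (U : Vector ℂ n) → ∑[ i < n ] (U i *ᶜ indicator (P? i)) ≈ᶜ U δ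
  ∑-indicator P? zero Pδ unique U = ℂR.trans
    (ℂR.+-cong
      (ℂR.trans (ℂR.*-congˡ (indicator-yes (P? zero) Pδ)) (ℂR.*-identityʳ _))
      (∑-zero λ i → ℂR.trans (ℂR.*-congˡ (indicator-no (P? (suc i)) ((λ ()) ∘ unique))) (ℂR.zeroʳ _)))
    (ℂR.+-identityʳ _)
  ∑-indicator P? (suc δ) Pδ unique U = ℂR.trans
    (ℂR.+-cong
      (ℂR.trans (ℂR.*-congˡ (indicator-no (P? zero) ((λ ()) ∘ unique))) (ℂR.zeroʳ _))
      (∑-indicator (P? ∘ suc) δ Pδ (suc-injective ∘ unique) (U ∘ suc)))
    (ℂR.+-identityˡ _)

  -- Partition of a sum by a class map with finitely many values.

  fibre : ∀ {I : Set} {n} → (I → Fin n) → List I → Fin n → List I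
  fibre cls S δ = filter (λ i → cls i ≟ᶠ δ) S

  sumList-fibre-∷ : ∀ {I : Set} {n} (cls : I → Fin n) (f : I → ℂ) i S δ →
    sumList f (fibre cls (i ∷ S) δ) ≈ᶜ f i *ᶜ indicator (cls i ≟ᶠ δ) +ᶜ sumList f (fibre cls S δ)
  sumList-fibre-∷ cls f i S δ with cls i ≟ᶠ δ
  ... | yes _ = ℂR.+-congʳ (ℂR.sym (ℂR.*-identityʳ _))
  ... | no  _ = ℂR.sym (ℂR.trans (ℂR.+-congʳ (ℂR.zeroʳ _)) (ℂR.+-identityˡ _))

  -- A new entry `i` changes only the fibre over `cls i`, so the sum of indicators counts `f i`
  -- exactly once.
  ∑-sumList-fibre : ∀ {I : Set} {n} (cls : I → Fin n) (f : I → ℂ) S →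
    ∑[ δ < n ] sumList f (fibre cls S δ) ≈ᶜ sumList f S
  ∑-sumList-fibre {n = n} cls f [] = ∑-zero {n} (λ _ → ℂR.refl)
  ∑-sumList-fibre cls f (i ∷ S) = ℂR.trans (sum-cong-≋ (sumList-fibre-∷ cls f i S))
    (ℂR.trans
      (∑-distrib-+ (λ δ → f i *ᶜ indicator (cls i ≟ᶠ δ)) (λ δ → sumList f (fibre cls S δ)))
      (ℂR.+-cong (∑-indicator (cls i ≟ᶠ_) (cls i) ≡.refl ≡.sym (λ _ → f i)) (∑-sumList-fibre cls f S)))

  -- The witness joins the witnesses of all classes. In any larger duplicate-free list, each fibre
  -- is duplicate-free, lies in its class and contains the witness of that class, so the errors of
  -- the fibres add up.
  SumsTo-partition : ∀ {I : Set} {n} (cls : I → Fin n) {f : I → ℂ} {t : Vector ℂ n} →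
    (∀ δ → SumsTo (λ i → cls i ≡ δ) f (t δ)) → SumsTo (λ _ → ⊤) f (∑[ δ < n ] t δ)
  -- The error is split into n + 1 parts to match the bound of `Close-∑`.
  SumsTo-partition {n = n} cls {f} h ε 0<ε with 0<ε ÷suc n
  ... | η , 0<η , nη≈ε = S , All.universal (λ _ → tt) S , λ S′ u _ S⊆S′ →
    Close-cong nη≈ε (∑-sumList-fibre cls f S′) ℂR.refl
      (Close-∑ 0<η λ δ → proj₂ (proj₂ (h δ η 0<η)) (fibre cls S′ δ)
        (Unique.filter⁺ (λ i → cls i ≟ᶠ δ) u)
        (All.all-filter (λ i → cls i ≟ᶠ δ) S′)
        (λ i∈ → ∈-filter⁺ (λ i → cls i ≟ᶠ δ)
          (S⊆S′ (∈-concat⁺′ i∈ (∈-tabulate⁺ {f = part} δ)))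
          (All.lookup (proj₁ (proj₂ (h δ η 0<η))) i∈)))
    where
    part : Fin n → List _
    part δ = proj₁ (h δ η 0<η)
    S = concat (tabulate part)

  -- Adjointness of the matrix `c`: once the two finite sums are exchanged, the inner sum over δ is
  -- the assumed expansion of `Θ γ`.
  ∑-transpose : ∀ {m n} {Θ : Vector ℂ m} {Θ′ : Vector ℂ n} {c : Fin m → Fin n → ℂ} {U : Vector ℂ m} →
    (∀ γ → Θ γ ≈ᶜ ∑[ δ < n ] (Θ′ δ *ᶜ c γ δ)) →
    ∑[ δ < n ] (Θ′ δ *ᶜ (∑[ γ < m ] (U γ *ᶜ c γ δ))) ≈ᶜ ∑[ γ < m ] (Θ γ *ᶜ U γ)
  ∑-transpose {m} {n} {Θ} {Θ′} {c} {U} Θ≈ = begin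
    ∑[ δ < n ] (Θ′ δ *ᶜ (∑[ γ < m ] (U γ *ᶜ c γ δ)))
      ≈⟨ sum-cong-≋ (λ δ → *-distribˡ-sum (Θ′ δ) (λ γ → U γ *ᶜ c γ δ)) ⟩
    ∑[ δ < n ] ∑[ γ < m ] (Θ′ δ *ᶜ (U γ *ᶜ c γ δ))
      ≈⟨ ∑-comm (λ δ γ → Θ′ δ *ᶜ (U γ *ᶜ c γ δ)) ⟩
    ∑[ γ < m ] ∑[ δ < n ] (Θ′ δ *ᶜ (U γ *ᶜ c γ δ))
      ≈⟨ sum-cong-≋ (λ γ → sum-cong-≋ λ δ → swap (Θ′ δ) (U γ) (c γ δ)) ⟩
    ∑[ γ < m ] ∑[ δ < n ] ((Θ′ δ *ᶜ c γ δ) *ᶜ U γ)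
      ≈⟨ sum-cong-≋ (λ γ → *-distribʳ-sum (U γ) (λ δ → Θ′ δ *ᶜ c γ δ)) ⟨
    ∑[ γ < m ] ((∑[ δ < n ] (Θ′ δ *ᶜ c γ δ)) *ᶜ U γ)
      ≈⟨ sum-cong-≋ (λ γ → ℂR.*-congʳ (Θ≈ γ)) ⟨
    ∑[ γ < m ] (Θ γ *ᶜ U γ) ∎
    where
    swap : ∀ a b d → a *ᶜ (b *ᶜ d) ≈ᶜ (a *ᶜ d) *ᶜ b
    swap a b d = ℂR.trans (ℂR.*-congˡ (ℂR.*-comm b d)) (ℂR.sym (ℂR.*-assoc a d b))

-- Theta series of L and of Λ.

module ThetaSplitting (𝓡 : RealField) (𝓔 : Exponential.ExpPi 𝓡) where

  open RealField 𝓡 renaming (Carrier to ℝ)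
  open RealExtras 𝓡
  open OrderedField 𝓡
  open Complex 𝓡
  open Exponential.ExpPi 𝓔
  open Theory 𝓡 𝓔
  open Summation 𝓡 𝓔
  open IsStrictPartialOrder isStrictPartialOrder using (asym)
  open Discriminant using (card; rep)
  open import Algebra.Properties.Semiring.Sum ℂR.semiring using (sum-cong-≋)

  open import Relation.Binary.Reasoning.Setoid (CommutativeRing.setoid commutativeRing)

  pairᴿ-cong : ∀ L {x x′ y y′ : Lᴿ L} → (∀ i → x i ≈ x′ i) → (∀ i → y i ≈ y′ i) →
    pairᴿ L x y ≈ pairᴿ L x′ y′
  pairᴿ-cong L = form-cong (λ _ _ → refl)

  Subspace-difference : ∀ {n} (W : Subspace n) → let open Subspace W in
    ∀ {x y} → x ∈ⱽ → y ∈ⱽ → (λ i → x i - y i) ∈ⱽ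
  Subspace-difference W {x} {y} x∈ y∈ = resp
    (λ i → solve 2 (λ a b → a :+ (:- con (+ 1)) :* b := a :- b) refl (x i) (y i))
    (+-closed x∈ (·-closed (- ι (+ 1)) y∈))
    where open Subspace W

  -- Uniqueness of the orthogonal decomposition.

  module _ {L : EvenLattice} (v : Gr L) where

    open Gr v

    -- A coordinate apart from 0 would make the square of `x` both positive and negative; tightness
    -- turns this into vanishing.
    v₊∩v₋≈0 : ∀ {x} → x ∈v₊ → x ∈v₋ → ∀ i → x i ≈ 0#
    v₊∩v₋≈0 x∈v₊ x∈v₋ i = ≈-of-¬# λ xi#0 → asym (positive x∈v₊ i xi#0) (negative x∈v₋ i xi#0)

    -- `decompose` is a bare function on vectors; that it respects `≈` follows from uniqueness. The
    -- difference of the positive parts is minus that of the negative parts, hence lies in both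
    -- subspaces.
    proj-cong : ∀ {x y} → (∀ i → x i ≈ y i) →
      (∀ i → proj₊ x i ≈ proj₊ y i) × (∀ i → proj₋ x i ≈ proj₋ y i)
    proj-cong {x} {y} x≈y with decompose x | decompose y
    ... | x₊ , x₋ , x₊∈ , x₋∈ , x≈ | y₊ , y₋ , y₊∈ , y₋∈ , y≈ =
      (λ i → difference≈0 (d₊≈0 i)) ,
      (λ i → sym (difference≈0 (trans (sym (d₊≈d₋ i)) (d₊≈0 i))))
      where
      difference≈0 : ∀ {a b} → a - b ≈ 0# → a ≈ b
      difference≈0 {a} {b} p =
        trans (solve 2 (λ a b → a := (a :- b) :+ b) refl a b) (trans (+-congʳ p) (+-identityˡ b))
      d₊≈d₋ : ∀ i → x₊ i - y₊ i ≈ y₋ i - x₋ i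
      d₊≈d₋ i = trans
        (solve 4 (λ a b c d → a :- c := ((a :+ b) :- b) :- c) refl (x₊ i) (x₋ i) (y₊ i) (y₋ i))
        (trans (+-congʳ (+-congʳ (trans (sym (x≈ i)) (trans (x≈y i) (y≈ i)))))
        (solve 3 (λ b c d → ((c :+ d) :- b) :- c := d :- b) refl (x₋ i) (y₊ i) (y₋ i)))
      d₊≈0 = v₊∩v₋≈0 (Subspace-difference v₊ x₊∈ y₊∈)
        (Subspace.resp v₋ (λ i → sym (d₊≈d₋ i)) (Subspace-difference v₋ y₋∈ x₋∈))

    thetaTerm-cong : ∀ τ ζ {x y} → (∀ i → x i ≈ y i) → thetaTerm v τ ζ x ≈ᶜ thetaTerm v τ ζ y
    thetaTerm-cong τ ζ x≈y = exp-cong (ℂR.*-congˡ (ℂR.+-cong (ℂR.+-cong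
      (ℂR.*-congˡ (half (proj₁ (proj-cong x≈y))))
      (ℂR.*-congˡ (half (proj₂ (proj-cong x≈y)))))
      (RingExtras.form-cong ℂ-commutativeRing (λ _ _ → ℂR.refl) (λ i → x≈y i ,ᶜ refl) (λ _ → ℂR.refl))))
      where
      half : ∀ {x y} → (∀ i → x i ≈ y i) →
        ofℝ (pairᴿ L x x * recip 2) ≈ᶜ ofℝ (pairᴿ L y y * recip 2)
      half p = *-congʳ (pairᴿ-cong L p p) ,ᶜ refl

  -- Equivalent to `LiesOver`, but free of the bilinear form, so that L and L(-1) share it.
  Congruent : ∀ {L Λ} (𝓓ᴸ : Discriminant L whole) (𝓓ᴧ : Discriminant L Λ) →
    Fin (card 𝓓ᴸ) → Fin (card 𝓓ᴧ) → Set
  Congruent {L} 𝓓ᴸ 𝓓ᴧ γ δ = _≡ᴹ_ L whole (rep 𝓓ᴧ δ) (rep 𝓓ᴸ γ)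

  -- The form is integral on L, so adding an element of L changes pairings with L by integers.
  InDual-≡ᴹ : ∀ L {x y} → _≡ᴹ_ L whole x y → InDual L whole y → InDual L whole x
  InDual-≡ᴹ L {x} {y} (n , _ , x-y≈n) y∈ m _ with y∈ m tt
  ... | k , eq = k ℤ.+ EvenLattice.⟪_,_⟫ L n m , (begin
    pairᴿ L x (emb m)
      ≈⟨ pairᴿ-cong L
           (λ i → trans (solve 2 (λ a b → a := b :+ (a :- b)) refl (x i) (y i)) (+-congˡ (x-y≈n i)))
           (λ _ → refl) ⟩
    pairᴿ L (λ i → y i + emb n i) (emb m)
      ≈⟨ form-+ˡ (λ i j → ι (gram L i j)) y (emb n) (emb m) ⟩
    pairᴿ L y (emb m) + pairᴿ L (emb n) (emb m)
      ≈⟨ +-cong eq (sym (ι-form commutativeRing (gram L) (lookup n) (lookup m))) ⟩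
    ι k + ι (EvenLattice.⟪_,_⟫ L n m)
      ≈⟨ ι-+ k (EvenLattice.⟪_,_⟫ L n m) ⟨
    ι (k ℤ.+ EvenLattice.⟪_,_⟫ L n m) ∎)

  module _ {L : EvenLattice} {Λ : Sublattice (rank L)}
           (𝓓ᴸ : Discriminant L whole) (𝓓ᴧ : Discriminant L Λ) where

    private
      module DL = Discriminant 𝓓ᴸ
      module DΛ = Discriminant 𝓓ᴧ
      module Λ = Sublattice Λ

    liesOver⇒congruent : ∀ γ δ → Arrow.LiesOver 𝓓ᴸ 𝓓ᴧ γ δ → Congruent 𝓓ᴸ 𝓓ᴧ γ δ
    liesOver⇒congruent γ δ (δ∈ , class≡γ) =
      Setoid.sym (D L whole) {DL.representative γ} {DΛ.rep δ , δ∈}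
        (DL.inverseʳ {DΛ.rep δ , δ∈} {γ} (≡.sym class≡γ))

    congruent⇒liesOver : ∀ γ δ → Congruent 𝓓ᴸ 𝓓ᴧ γ δ → Arrow.LiesOver 𝓓ᴸ 𝓓ᴧ γ δ
    congruent⇒liesOver γ δ δ≡γ = δ∈ , DL.inverseˡ {γ} {DΛ.rep δ , δ∈} δ≡γ
      where
      δ∈ : InDual L whole (DΛ.rep δ)
      δ∈ = InDual-≡ᴹ L δ≡γ (proj₂ (DL.representative γ))

    congruent? : ∀ γ δ → Dec (Congruent 𝓓ᴸ 𝓓ᴧ γ δ)
    congruent? γ δ =
      map′ (liesOver⇒congruent γ δ) (congruent⇒liesOver γ δ) (Arrow.liesOver? 𝓓ᴸ 𝓓ᴧ γ δ)

    ↑𝔢-indicates : ∀ γ δ → Indicates (Congruent 𝓓ᴸ 𝓓ᴧ γ δ) (Arrow.↑𝔢 𝓓ᴸ 𝓓ᴧ γ δ)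
    ↑𝔢-indicates γ δ = record
      { true  = λ δ≡γ → indicator-yes (Arrow.liesOver? 𝓓ᴸ 𝓓ᴧ γ δ) (congruent⇒liesOver γ δ δ≡γ)
      ; false = λ δ≢γ → indicator-no (Arrow.liesOver? 𝓓ᴸ 𝓓ᴧ γ δ) (δ≢γ ∘ liesOver⇒congruent γ δ)
      }

    translate : Fin DL.card → LatVec (rank L) → Lᴿ L
    translate γ m i = DL.rep γ i + emb m i

    abstract
      -- γ + m stays in L*, and L* ⊆ Λ* because Λ ⊆ L.
      translate∈ : ∀ γ m → InDual L Λ (translate γ m)
      translate∈ γ m k _ = InDual-≡ᴹ L {translate γ m} {DL.rep γ}
        (m , tt , λ i → solve 2 (λ g a → (g :+ a) :- g := a) refl (DL.rep γ i) (emb m i))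
        (proj₂ (DL.representative γ)) k tt

    -- For fixed γ this is the class map of the rearrangement: it partitions L by the coset of Λ
    -- that contains γ + m.
    translateClass : Fin DL.card → LatVec (rank L) → Fin DΛ.card
    translateClass γ m = DΛ.class (translate γ m , translate∈ γ m)

    class⇒≡ᴹ : ∀ {γ m δ} → translateClass γ m ≡ δ → _≡ᴹ_ L Λ (DΛ.rep δ) (translate γ m)
    class⇒≡ᴹ {γ} {m} {δ} eq = DΛ.inverseʳ {translate γ m , translate∈ γ m} {δ} (≡.sym eq)

    ≡ᴹ⇒class : ∀ {γ m δ} → _≡ᴹ_ L Λ (translate γ m) (DΛ.rep δ) → translateClass γ m ≡ δ
    ≡ᴹ⇒class {γ} {m} {δ} = DΛ.inverseˡ {δ} {translate γ m , translate∈ γ m}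

    -- δ - γ is `m` plus δ - (γ + m), and the latter lies in Λ ⊆ L.
    class⇒congruent : ∀ {γ δ} m → translateClass γ m ≡ δ → Congruent 𝓓ᴸ 𝓓ᴧ γ δ
    class⇒congruent {γ} {δ} m eq = m +ᴸ k , tt , λ i → trans
      (solve 3 (λ d g a → d :- g := a :+ (d :- (g :+ a))) refl (DΛ.rep δ i) (DL.rep γ i) (emb m i))
      (trans (+-congˡ (e i)) (sym (ι-lookup-+ m k i)))
      where
      δ≡γ+m = class⇒≡ᴹ {γ} {m} {δ} eq
      k = proj₁ δ≡γ+m
      e = proj₂ (proj₂ δ≡γ+m)

    -- The shift by n = δ - γ is to match Λ + δ, term by term, with the part of γ + L of class δ.
    translate-shift : ∀ {γ δ} (δ≡γ : Congruent 𝓓ᴸ 𝓓ᴧ γ δ) m i →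
      translate γ (m +ᴸ proj₁ δ≡γ) i ≈ DΛ.rep δ i + emb m i
    translate-shift {γ} {δ} (n , _ , δ-γ≈n) m i =
      trans (+-congˡ (trans (ι-lookup-+ m n i) (+-congˡ (sym (δ-γ≈n i)))))
        (solve 3 (λ g a d → g :+ (a :+ (d :- g)) := d :+ a) refl (DL.rep γ i) (emb m i) (DΛ.rep δ i))

    shift-class : ∀ {γ δ} (δ≡γ : Congruent 𝓓ᴸ 𝓓ᴧ γ δ) {m} →
      m Λ.∈ᴹ → translateClass γ (m +ᴸ proj₁ δ≡γ) ≡ δ
    shift-class {γ} {δ} δ≡γ {m} m∈ =
      ≡ᴹ⇒class {γ} {m +ᴸ n} {δ}
        (m , m∈ , λ i → trans (+-congʳ (translate-shift {γ} {δ} δ≡γ m i))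
          (solve 2 (λ d a → (d :+ a) :- d := a) refl (DΛ.rep δ i) (emb m i)))
      where n = proj₁ δ≡γ

    -- With n = δ - γ, m - n is the negative of δ - (γ + m), which lies in Λ.
    class-shift : ∀ {γ δ} (δ≡γ : Congruent 𝓓ᴸ 𝓓ᴧ γ δ) {m} →
      translateClass γ m ≡ δ → (m +ᴸ (-ᴸ proj₁ δ≡γ)) Λ.∈ᴹ
    class-shift {γ} {δ} (n , _ , δ-γ≈n) {m} eq =
      -- The two vectors are compared in ℝ; `ι-injective` brings the equality back to ℤ, where
      -- membership in Λ can be transported.
      ≡.subst Λ._∈ᴹ (lookup-injective λ i → ι-injective (-k≈m-n i))
        (Λ.neg-closed (proj₁ (proj₂ δ≡γ+m)))
      where
      δ≡γ+m = class⇒≡ᴹ {γ} {m} {δ} eq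
      k = proj₁ δ≡γ+m
      -k≈m-n : ∀ i → emb (-ᴸ k) i ≈ emb (m +ᴸ (-ᴸ n)) i
      -k≈m-n i = begin
        emb (-ᴸ k) i
          ≈⟨ ι-lookup-neg k i ⟩
        - emb k i
          ≈⟨ -‿cong (proj₂ (proj₂ δ≡γ+m) i) ⟨
        - (DΛ.rep δ i - (DL.rep γ i + emb m i))
          ≈⟨ solve 3 (λ d g a → :- (d :- (g :+ a)) := a :- (d :- g)) refl (DΛ.rep δ i) (DL.rep γ i) (emb m i) ⟩
        emb m i - (DΛ.rep δ i - DL.rep γ i)
          ≈⟨ +-congˡ (-‿cong (δ-γ≈n i)) ⟩
        emb m i - emb n i
          ≈⟨ +-congˡ (ι-lookup-neg n i) ⟨
        emb m i + emb (-ᴸ n) i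
          ≈⟨ ι-lookup-+ m (-ᴸ n) i ⟨
        emb (m +ᴸ (-ᴸ n)) i ∎

    -- Splitting of the components of the theta function.

    module _ (v : Gr L) (Θᴸ : ℋ → Lᶜ L → ℂ[ 𝓓ᴸ ]) (isThetaᴸ : IsTheta v 𝓓ᴸ Θᴸ)
             (Θᴧ : ℋ → Lᶜ L → ℂ[ 𝓓ᴧ ]) (isThetaᴧ : IsTheta v 𝓓ᴧ Θᴧ)
             (c : Fin DL.card → Fin DΛ.card → ℂ)
             (c-indicates : ∀ γ δ → Indicates (Congruent 𝓓ᴸ 𝓓ᴧ γ δ) (c γ δ))
             (τ : ℋ) (ζ : Lᶜ L) where

      term : Fin DL.card → LatVec (rank L) → ℂ
      term γ m = thetaTerm v τ ζ (translate γ m)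

      congruent-SumsTo : ∀ γ δ → Congruent 𝓓ᴸ 𝓓ᴧ γ δ →
        SumsTo (λ m → translateClass γ m ≡ δ) (term γ) (Θᴧ τ ζ δ)
      congruent-SumsTo γ δ δ≡γ = SumsTo-reindex
        {P = Λ._∈ᴹ} {Q = λ m → translateClass γ m ≡ δ}
        {f = λ m → thetaTerm v τ ζ (λ i → DΛ.rep δ i + emb m i)} {g = term γ} {s = Θᴧ τ ζ δ}
        (_+ᴸ n) (_+ᴸ (-ᴸ n)) (λ m → +ᴸ-cancel-neg m n) (λ m → neg-+ᴸ-cancel m n)
        (λ {m} → shift-class {γ} {δ} δ≡γ {m})
        (λ {m} → class-shift {γ} {δ} δ≡γ {m})
        (λ m → thetaTerm-cong v τ ζ (translate-shift {γ} {δ} δ≡γ m))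
        (HasSum⇒SumsTo (isThetaᴧ τ ζ δ))
        where n = proj₁ δ≡γ

      -- If δ does not lie over γ, then no `m` has class δ and the coefficient is 0; otherwise the
      -- coefficient is 1.
      class-SumsTo : ∀ γ δ →
        SumsTo (λ m → translateClass γ m ≡ δ) (term γ) (Θᴧ τ ζ δ *ᶜ c γ δ)
      class-SumsTo γ δ = cases (congruent? γ δ)
        where
        cases : Dec (Congruent 𝓓ᴸ 𝓓ᴧ γ δ) →
          SumsTo (λ m → translateClass γ m ≡ δ) (term γ) (Θᴧ τ ζ δ *ᶜ c γ δ)
        cases (yes δ≡γ) = SumsTo-congˢ
          (ℂR.sym (ℂR.trans (ℂR.*-congˡ (Indicates.true (c-indicates γ δ) δ≡γ)) (ℂR.*-identityʳ _)))
          (congruent-SumsTo γ δ δ≡γ)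
        cases (no δ≢γ) = SumsTo-congˢ
          (ℂR.sym (ℂR.trans (ℂR.*-congˡ (Indicates.false (c-indicates γ δ) δ≢γ)) (ℂR.zeroʳ _)))
          (SumsTo-∅ λ m eq → δ≢γ (class⇒congruent {γ} {δ} m eq))

      -- Both sides sum the same terms over all of L, the right one grouped by class; unconditional
      -- sums are unique.
      theta-splits : ∀ γ → Θᴸ τ ζ γ ≈ᶜ ∑[ δ < DΛ.card ] (Θᴧ τ ζ δ *ᶜ c γ δ)
      theta-splits γ = SumsTo-unique (≡-dec ℤ._≟_) (HasSum⇒SumsTo (isThetaᴸ τ ζ γ))
        (SumsTo-partition (translateClass γ) (class-SumsTo γ))

  ω-coefficient : ∀ {L M} (𝓓 : Discriminant L M) U δ → ω 𝓓 U δ ≈ᶜ U δ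
  ω-coefficient 𝓓 U δ = ∑-indicator (_≟ᶠ δ) δ ≡.refl (λ eq → eq) U

  pairing-congʳ : ∀ {L M} (𝓓 : Discriminant L M) U {V W} → (∀ δ → V δ ≈ᶜ W δ) →
    pairing 𝓓 U V ≈ᶜ pairing 𝓓 U W
  pairing-congʳ 𝓓 U V≈W = sum-cong-≋ λ δ → ℂR.*-congˡ (V≈W δ)

  -- Transfer to L(-1).

  module _ {L : EvenLattice} {Λ : Sublattice (rank L)}
           (𝓓ᴸ : Discriminant L whole) (𝓓ᴧ : Discriminant L Λ) where

    -- Named with their types, since inference would η-expand L in 𝓓 ⟨-1⟩ᴰ, after
    -- which conversion checking compares the proofs inside the negated lattices.
    𝓓ᴸ⁻ : Discriminant (L ⟨-1⟩) whole
    𝓓ᴸ⁻ = 𝓓ᴸ ⟨-1⟩ᴰ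

    𝓓ᴧ⁻ : Discriminant (L ⟨-1⟩) Λ
    𝓓ᴧ⁻ = _⟨-1⟩ᴰ {L} {Λ} 𝓓ᴧ

    -- Negating the form changes neither the representatives nor congruence modulo L, so the result
    -- for the negated lattices already has this type.
    ↑𝔢⁻-indicates : ∀ γ δ → Indicates (Congruent 𝓓ᴸ 𝓓ᴧ γ δ) (Arrow.↑𝔢 𝓓ᴸ⁻ 𝓓ᴧ⁻ γ δ)
    ↑𝔢⁻-indicates = ↑𝔢-indicates 𝓓ᴸ⁻ 𝓓ᴧ⁻

proposition3p4 :
  (𝓡 : RealField) (𝓔 : Exponential.ExpPi 𝓡) →
  let open Complex 𝓡
      open Theory 𝓡 𝓔
  in
  (L : EvenLattice) (b₊ b₋ : ℕ) → HasSignature L b₊ b₋ →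
  (Λ : Sublattice (EvenLattice.rank L)) →
  (𝓓ᴸ : Discriminant L whole) (𝓓ᴧ : Discriminant L Λ) →
  (v : Gr L) →
  (Θᴸ : ℋ → Lᶜ L → ℂ[ 𝓓ᴸ ]) → IsTheta v 𝓓ᴸ Θᴸ →
  (Θᴧ : ℋ → Lᶜ L → ℂ[ 𝓓ᴧ ]) → IsTheta v 𝓓ᴧ Θᴧ →
  (Γ : Subgroup) → FiniteIndex Γ →
  (k l : ½ℤ) →
  (ρ : Mp₂ℤ → ℂ[ 𝓓ᴸ ] → ℂ[ 𝓓ᴸ ]) →
  IsWeilRepresentation 𝓓ᴸ b₊ b₋ ρ →
  (ρ* : Mp₂ℤ → ℂ[ 𝓓ᴸ ⟨-1⟩ᴰ ] → ℂ[ 𝓓ᴸ ⟨-1⟩ᴰ ]) →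
  IsWeilRepresentation (𝓓ᴸ ⟨-1⟩ᴰ) b₋ b₊ ρ* →
  (F : ℋ → ℂ[ 𝓓ᴸ ⟨-1⟩ᴰ ]) →
  IsModularForm (k -½ b₊) (l -½ b₋) ρ* (Subgroup._∈ᴳ Γ) F →
  (G : ℋ → ℂ[ 𝓓ᴸ ]) →
  IsModularForm (k -½ b₋) (l -½ b₊) ρ (tilde (Subgroup._∈ᴳ Γ)) G →
  (∀ τ ζ → Φ 𝓓ᴧ Θᴧ (λ σ → Arrow.↑ (𝓓ᴸ ⟨-1⟩ᴰ) (𝓓ᴧ ⟨-1⟩ᴰ) (F σ)) τ ζ ≈ᶜ Φ 𝓓ᴸ Θᴸ F τ ζ)
  × (∀ τ ζ → Φ̃ 𝓓ᴧ Θᴧ (λ σ → Arrow.↑ 𝓓ᴸ 𝓓ᴧ (G σ)) τ ζ ≈ᶜ Φ̃ 𝓓ᴸ Θᴸ G τ ζ)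
proposition3p4 𝓡 𝓔 L _ _ _ Λ 𝓓ᴸ 𝓓ᴧ v Θᴸ isThetaᴸ Θᴧ isThetaᴧ _ _ _ _ _ _ _ _ F _ G _ =
  -- The arrow on `F` is that of L(-1); its matrix indicates the same congruence by which the theta
  -- function splits.
  (λ τ ζ → ∑-transpose {card 𝓓ᴸ} {card 𝓓ᴧ} {Θᴸ τ ζ} {Θᴧ τ ζ} {U = F τ}
    (theta-splits 𝓓ᴸ 𝓓ᴧ v Θᴸ isThetaᴸ Θᴧ isThetaᴧ _ (↑𝔢⁻-indicates 𝓓ᴸ 𝓓ᴧ) τ ζ)) ,
  -- `ω` is removed on both sides, which leaves the transposition for `G (-conjᴴ τ)`.
  (λ τ ζ → ℂR.trans (pairing-congʳ 𝓓ᴧ (Θᴧ τ ζ) (ω-coefficient 𝓓ᴧ (Arrow.↑ 𝓓ᴸ 𝓓ᴧ (G (-conjᴴ τ)))))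
    (ℂR.trans
      (∑-transpose {card 𝓓ᴸ} {card 𝓓ᴧ} {Θᴸ τ ζ} {Θᴧ τ ζ} {U = G (-conjᴴ τ)}
        (theta-splits 𝓓ᴸ 𝓓ᴧ v Θᴸ isThetaᴸ Θᴧ isThetaᴧ _ (↑𝔢-indicates 𝓓ᴸ 𝓓ᴧ) τ ζ))
      (ℂR.sym (pairing-congʳ 𝓓ᴸ (Θᴸ τ ζ) (ω-coefficient 𝓓ᴸ (G (-conjᴴ τ)))))))
  where
  open Complex 𝓡
  open Theory 𝓡 𝓔
  open Summation 𝓡 𝓔
  open ThetaSplitting 𝓡 𝓔
  open Discriminant using (card)
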